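{- Let $F(n)$ denote the number of 1-factorizations of the complete graph $K_n$ on the vertex set $[n]$. Then, as $n\to\infty$, $$ F(n) \leq \left( (1 + o(1)) \frac{n}{e^2} \right)^{\frac{n^2}{2}} ;$$ that is, there is a function $\varepsilon(n)\to 0$ as $n\to\infty$ such that $F(n) \le \left((1+\varepsilon(n))\frac{n}{e^2}\right)^{n^2/2}$ for every $n$.
   Context: A 1-factorization of $K_n$ is a partition of the edge set of $K_n$ into $n-1$ perfect matchings, equivalently a proper edge coloring of $K_n$ with $n-1$ colors (here the factorizations are counted as partitions of the labeled edge set, or equivalently as colorings with color set $[n-1]$, as in the paper's convention of coloring with colors $[n-1]$). A 1-factorization of $K_n$ exists if and only if $n$ is even; for odd $n$, $F(n)=0$. Here $e$ is the base of the natural logarithm. -}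

module Defs where

open import Data.Nat using (ℕ; zero; suc; _+_; _*_; _∸_; _^_; _≤_; _<_)
open import Data.Nat using (_!)
open import Data.Fin using (Fin; _<?_) renaming (_<_ to _<ᶠ_)
open import Data.Fin.Properties using (all?) renaming (_≟_ to _≟ᶠ_)
open import Data.Product using (Σ; _×_; _,_; proj₁; proj₂)
open import Data.Sum using (_⊎_)
open import Data.List using (List; []; _∷_; [_]; map; concatMap; length; filter; cartesianProduct; allFin)
open import Data.Vec using (Vec; lookup) renaming ([] to []ᵥ; _∷_ to _∷ᵥ_)
open import Relation.Nullary using (¬_; Dec)
open import Relation.Nullary.Decidable using (_⊎-dec_; _→-dec_; ¬?)
open import Relation.Binary.PropositionalEquality using (_≡_)

edges : (n : ℕ) → List (Fin n × Fin n)
edges n = filter (λ e → proj₁ e <? proj₂ e) (cartesianProduct (allFin n) (allFin n))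

E : ℕ → ℕ
E n = length (edges n)

edge : (n : ℕ) → Fin (E n) → Fin n × Fin n
edge n p = Data.List.lookup (edges n) p

Adjacent : (n : ℕ) → Fin (E n) → Fin (E n) → Set
Adjacent n p q =
  let (a , b) = edge n p ; (c , d) = edge n q in
  (a ≡ c ⊎ a ≡ d) ⊎ (b ≡ c ⊎ b ≡ d)

adjacent? : (n : ℕ) → (p q : Fin (E n)) → Dec (Adjacent n p q)
adjacent? n p q =
  let (a , b) = edge n p ; (c , d) = edge n q in
  ((a ≟ᶠ c) ⊎-dec (a ≟ᶠ d)) ⊎-dec ((b ≟ᶠ c) ⊎-dec (b ≟ᶠ d))

Coloring : ℕ → Set
Coloring n = Vec (Fin (n ∸ 1)) (E n)

-- Proper: distinct edges sharing an endpoint get distinct colors.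
-- A proper (n-1)-edge-coloring of K_n is exactly a 1-factorization
-- (each color class is a perfect matching) with color classes labelled by [n-1].
Proper : (n : ℕ) → Coloring n → Set
Proper n col = ∀ p q → ¬ (p ≡ q) → Adjacent n p q → ¬ (lookup col p ≡ lookup col q)

proper? : (n : ℕ) → (col : Coloring n) → Dec (Proper n col)
proper? n col = all? λ p → all? λ q →
  ¬? (p ≟ᶠ q) →-dec (adjacent? n p q →-dec ¬? (lookup col p ≟ᶠ lookup col q))

allVecs : (k m : ℕ) → List (Vec (Fin k) m)
allVecs k zero    = [ []ᵥ ]
allVecs k (suc m) = concatMap (λ x → map (x ∷ᵥ_) (allVecs k m)) (allFin k)

F : ℕ → ℕ
F n = length (filter (proper? n) (allVecs (n ∸ 1) (E n)))

-- S k = Σ_{j=0}^{k} k!/j!, so S k / k! = Σ_{j ≤ k} 1/j! increases to e.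
S : ℕ → ℕ
S zero    = 1
S (suc k) = suc k * S k + 1

-- The positive rational a/b exceeds e^{-2}, i.e. (a/b)·e² > 1, i.e.
-- for some k, (a/b)·(S k / k!)² > 1.
AboveInvESq : ℕ → ℕ → Set
AboveInvESq a b = Σ ℕ λ k → b * (k ! * k !) < a * (S k * S k)

{-# OPTIONS --safe #-}
module Submission where

-- Fix T and give the edges independent uniform times in {0, …, T - 1}. Colouring the edges greedily
-- in the order of their times, choosing uniformly among the colours that no strictly earlier adjacent
-- edge uses, produces a given proper colouring X with probability ∏ₑ 1 / Nₑ(X), where Nₑ(X) is the
-- number of choices at e. These probabilities add up to at most 1, so by AM-GM the number of proper
-- colourings is at most the geometric mean, over all X and all times, of ∏ₑ Nₑ(X).
--
-- A colour c other than that of e = uv is available at e only if the c-edges at u and at v, which are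
-- two different edges, are not earlier than e. If e has time T - s, this has probability (s/T)², so
-- Nₑ(X) has mean at most 1 + n (s/T)² ≤ (s/T)² (n + T²). AM-GM for each s and the product over
-- s = 1, …, T give F(n)ᵀ ≤ ((T!)² (n + T²)ᵀ / T²ᵀ) ^ (number of edges). Now (T!)^(2/T) / T² → e⁻²
-- as T → ∞, so a suitable constant T suffices for all large n.

open import Defs
open import Algebra.Structures using (IsCommutativeMonoid)
open import Data.Bool using (if_then_else_; true; false)
open import Data.Fin as Fin using (Fin; zero; suc; toℕ; punchIn; punchOut)
import Data.Fin.Properties as Fin
open import Data.List as List using (List; []; _∷_; _++_; length; filter; allFin; map; concatMap; cartesianProduct)
import Data.List.Properties as List
import Data.List.Sort as Sort
open import Data.List.Membership.Propositional using (_∈_)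
open import Data.List.Membership.Propositional.Properties using (∈-filter⁺; ∈-filter⁻; ∈-allFin; ∈-lookup; ∈-cartesianProduct⁺; ∈-map⁻; ∈-++⁻)
open import Data.List.Relation.Binary.Permutation.Propositional as Perm using (_↭_; ↭-sym)
open import Data.List.Relation.Binary.Permutation.Propositional.Properties using (∈-resp-↭)
open import Data.List.Relation.Unary.All as All using (All; []; _∷_)
open import Data.List.Relation.Unary.AllPairs using (AllPairs; []; _∷_)
open import Data.List.Relation.Unary.Any using (here; there; index)
open import Data.List.Relation.Unary.Any.Properties using (lookup-index)
open import Data.List.Relation.Unary.Sorted.TotalOrder.Properties using (Sorted⇒AllPairs)
open import Data.List.Relation.Unary.Unique.Propositional using (Unique)
import Data.List.Relation.Unary.Unique.Propositional.Properties as Unique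
open import Data.Nat
open import Data.Nat.Divisibility using (∣-trans; m∣m*n; m≤n⇒m!∣n!)
open import Data.Nat.DivMod using (m/n*n≡m)
open import Data.Nat.Properties
open import Data.Nat.Tactic.RingSolver using (solve-∀)
open import Data.Product using (Σ; _×_; _,_; proj₁; proj₂)
open import Data.Sum using (_⊎_; inj₁; inj₂)
open import Data.Vec as Vec using (Vec; lookup; _[_]≔_)
open import Data.Vec.Properties using (lookup∘update′; tabulate∘lookup; tabulate-cong)
open import Function using (_∘_)
open import Level using (0ℓ)
open import Relation.Binary.Bundles using (DecTotalOrder)
import Relation.Binary.Construct.On as On
open import Relation.Binary.Definitions using (tri<; tri≈; tri>)
open import Relation.Binary.PropositionalEquality using (_≡_; _≢_; refl; sym; trans; cong; cong₂; subst; subst₂; module ≡-Reasoning)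
open import Relation.Nullary using (¬_; Dec; does; yes; no; contradiction)
open import Relation.Nullary.Decidable using (¬?; _→-dec_; dec-true; dec-false)
open import Relation.Unary using (Pred; Decidable)

-- Powers, Bernoulli's inequality and the extremal case of AM-GM.

^-distribʳ-* : ∀ m n o → (m * n) ^ o ≡ m ^ o * n ^ o
^-distribʳ-* m n zero    = refl
^-distribʳ-* m n (suc o) = trans (cong (m * n *_) (^-distribʳ-* m n o)) (swap m n (m ^ o) (n ^ o))
  where
  swap : ∀ m n p q → m * n * (p * q) ≡ m * p * (n * q)
  swap = solve-∀

^-comm : ∀ m n o → (m ^ n) ^ o ≡ (m ^ o) ^ n
^-comm m n o = trans (^-*-assoc m n o) (trans (cong (m ^_) (*-comm n o)) (sym (^-*-assoc m o n)))

^-cancelˡ-≤ : ∀ {m n} o → 0 < o → m ^ o ≤ n ^ o → m ≤ n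
^-cancelˡ-≤ {m} {n} o@(suc _) _ mᵒ≤nᵒ with m ≤? n
... | yes m≤n = m≤n
... | no  m≰n = contradiction mᵒ≤nᵒ (<⇒≱ (^-monoˡ-< o (≰⇒> m≰n)))

^-positive : ∀ {m} n → 0 < m → 0 < m ^ n
^-positive {m} n 0<m = m^n>0 m {{>-nonZero 0<m}} n

!-positive : ∀ n → 0 < n !
!-positive n = >-nonZero⁻¹ (n !) {{n !≢0}}

2mn≤m²+n² : ∀ m n → m * n + m * n ≤ m * m + n * n
2mn≤m²+n² m n with ≤-total m n
... | inj₁ m≤n with d , refl ← m≤n⇒∃[o]m+o≡n m≤n = ≤-trans (m≤m+n _ (d * d)) (≤-reflexive (expand m d))
  where
  expand : ∀ m d → m * (m + d) + m * (m + d) + d * d ≡ m * m + (m + d) * (m + d)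
  expand = solve-∀
... | inj₂ n≤m with d , refl ← m≤n⇒∃[o]m+o≡n n≤m = ≤-trans (m≤m+n _ (d * d)) (≤-reflexive (expand n d))
  where
  expand : ∀ n d → (n + d) * n + (n + d) * n + d * d ≡ (n + d) * (n + d) + n * n
  expand = solve-∀

-- Bernoulli's inequality 1 + (n + 1)(x - 1) ≤ xⁿ⁺¹ at x = α / β, without denominators.
bernoulli : ∀ n α β → suc n * (α * β ^ n) ≤ α ^ suc n + n * β ^ suc n
bernoulli zero    α β = ≤-reflexive (eq α)
  where
  eq : ∀ α → 1 * (α * 1) ≡ α * 1 + 0
  eq = solve-∀
-- The summand added to both sides makes the left side a multiple of `2 α β`, which is at most
-- `α² + β²`; the `α²` part is then `α` times the left side of the induction hypothesis.
bernoulli (suc n) α β = +-cancelʳ-≤ (n * (α * (β * b))) _ _ (begin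
    suc (suc n) * (α * (β * b)) + n * (α * (β * b))
      ≡⟨ eq₁ n α β b ⟩
    suc n * b * (α * β + α * β)
      ≤⟨ *-monoʳ-≤ (suc n * b) (2mn≤m²+n² α β) ⟩
    suc n * b * (α * α + β * β)
      ≡⟨ eq₂ n α β b ⟩
    α * (suc n * (α * b)) + suc n * (β * (β * b))
      ≤⟨ +-monoˡ-≤ _ (*-monoʳ-≤ α (bernoulli n α β)) ⟩
    α * (α * a + n * (β * b)) + suc n * (β * (β * b))
      ≡⟨ eq₃ n α β a b ⟩
    α * (α * a) + suc n * (β * (β * b)) + n * (α * (β * b)) ∎)
  where
  open ≤-Reasoning
  a = α ^ n
  b = β ^ n
  eq₁ : ∀ n α β b → suc (suc n) * (α * (β * b)) + n * (α * (β * b)) ≡ suc n * b * (α * β + α * β)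
  eq₁ = solve-∀
  eq₂ : ∀ n α β b → suc n * b * (α * α + β * β) ≡ α * (suc n * (α * b)) + suc n * (β * (β * b))
  eq₂ = solve-∀
  eq₃ : ∀ n α β a b → α * (α * a + n * (β * b)) + suc n * (β * (β * b))
                    ≡ α * (α * a) + suc n * (β * (β * b)) + n * (α * (β * b))
  eq₃ = solve-∀

-- Bernoulli's inequality `1 + n/m ≤ (1 + 1/m)ⁿ`, multiplied by `mⁿ⁺¹`.
m^n*[m+n]≤[1+m]^n*m : ∀ m n → m ^ n * (m + n) ≤ suc m ^ n * m
m^n*[m+n]≤[1+m]^n*m m zero = ≤-reflexive (cong (1 *_) (+-identityʳ m))
m^n*[m+n]≤[1+m]^n*m m (suc n) = begin
    m * p * (m + suc n)       ≤⟨ m≤m+n _ (p * n) ⟩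
    m * p * (m + suc n) + p * n ≡⟨ eq₁ m n p ⟩
    suc m * (p * (m + n))     ≤⟨ *-monoʳ-≤ (suc m) (m^n*[m+n]≤[1+m]^n*m m n) ⟩
    suc m * (suc m ^ n * m)   ≡⟨ *-assoc (suc m) (suc m ^ n) m ⟨
    suc m * suc m ^ n * m     ∎
  where
  open ≤-Reasoning
  p = m ^ n
  eq₁ : ∀ m n p → m * p * (m + suc n) + p * n ≡ suc m * (p * (m + n))
  eq₁ = solve-∀

-- The extremal case of AM-GM: bernoulli at α / β = n (s + x) / ((n + 1) s).
am-gm-step : ∀ n s x → s ^ n * x * suc n ^ suc n ≤ n ^ n * (s + x) ^ suc n
am-gm-step zero s x = begin
    1 * x * 1     ≡⟨ eq x ⟩
    x             ≤⟨ m≤n+m x s ⟩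
    s + x         ≡⟨ eq′ (s + x) ⟩
    1 * ((s + x) * 1) ∎
  where
  open ≤-Reasoning
  eq : ∀ x → 1 * x * 1 ≡ x
  eq = solve-∀
  eq′ : ∀ x → x ≡ 1 * (x * 1)
  eq′ = solve-∀
am-gm-step n@(suc _) s x = *-cancelˡ-≤ n (+-cancelʳ-≤ (n * (N * s) ^ suc n) _ _ (begin
    n * (s ^ n * x * N ^ suc n) + n * (N * s) ^ suc n
      ≡⟨ cong (λ z → n * (s ^ n * x * N ^ suc n) + n * z) (^-distribʳ-* N s (suc n)) ⟩
    n * (s ^ n * x * (N * N ^ n)) + n * (N * N ^ n * (s * s ^ n))
      ≡⟨ eq₁ n s x N (s ^ n) (N ^ n) ⟩
    N * (n * (s + x) * (N ^ n * s ^ n))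
      ≡⟨ cong (λ z → N * (n * (s + x) * z)) (^-distribʳ-* N s n) ⟨
    N * (n * (s + x) * (N * s) ^ n)
      ≤⟨ bernoulli n (n * (s + x)) (N * s) ⟩
    (n * (s + x)) ^ suc n + n * (N * s) ^ suc n
      ≡⟨ cong (_+ n * (N * s) ^ suc n) (^-distribʳ-* n (s + x) (suc n)) ⟩
    n * n ^ n * (s + x) ^ suc n + n * (N * s) ^ suc n
      ≡⟨ cong (_+ n * (N * s) ^ suc n) (*-assoc n (n ^ n) ((s + x) ^ suc n)) ⟩
    n * (n ^ n * (s + x) ^ suc n) + n * (N * s) ^ suc n ∎))
  where
  open ≤-Reasoning
  N = suc n
  eq₁ : ∀ n s x N p q → n * (p * x * (N * q)) + n * (N * q * (s * p)) ≡ N * (n * (s + x) * (q * p))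
  eq₁ = solve-∀

-- Partial sums of e

-- expSum x k y = k! xᵏ Σ_{i ≤ k} (y/x)ⁱ / i!
expSum : ℕ → ℕ → ℕ → ℕ
expSum x zero    y = 1
expSum x (suc k) y = suc k * x * expSum x k y + y ^ suc k

-- The mean value bound for `yᵏ⁺¹` with the derivative at the right end; it handles the top term in
-- `expSum-convex`.
[1+y]^[1+k]≤ : ∀ y k → suc y ^ suc k ≤ y ^ suc k + suc k * suc y ^ k
[1+y]^[1+k]≤ y zero    = ≤-reflexive (eq y)
  where
  eq : ∀ y → suc y * 1 ≡ y * 1 + 1
  eq = solve-∀
[1+y]^[1+k]≤ y (suc k) = begin
    suc y * suc y ^ suc k              ≤⟨ +-monoʳ-≤ _ (*-monoʳ-≤ y ([1+y]^[1+k]≤ y k)) ⟩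
    suc y ^ suc k + y * (y ^ suc k + suc k * suc y ^ k)
                                       ≤⟨ m≤m+n _ (suc k * suc y ^ k) ⟩
    suc y ^ suc k + y * (y ^ suc k + suc k * suc y ^ k) + suc k * suc y ^ k
                                       ≡⟨ eq y k (y ^ suc k) (suc y ^ k) ⟩
    y * y ^ suc k + suc (suc k) * suc y ^ suc k ∎
  where
  open ≤-Reasoning
  eq : ∀ y k p q → suc y * q + y * (p + suc k * q) + suc k * q ≡ y * p + suc (suc k) * (suc y * q)
  eq = solve-∀

-- Convexity: the increment over [y , y + 1] is at most the derivative at y + 1.
expSum-convex : ∀ x k y → expSum x (suc k) (suc y) ≤ expSum x (suc k) y + suc k * expSum x k (suc y)
expSum-convex x zero y = ≤-reflexive (eq x y)
  where
  eq : ∀ x y → 1 * x * 1 + suc y * 1 ≡ 1 * x * 1 + y * 1 + 1 * 1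
  eq = solve-∀
expSum-convex x (suc k) y = begin
    suc (suc k) * x * G₁′ + suc y ^ suc (suc k)
      ≤⟨ +-mono-≤ (*-monoʳ-≤ (suc (suc k) * x) (expSum-convex x k y)) ([1+y]^[1+k]≤ y (suc k)) ⟩
    suc (suc k) * x * (G₁ + suc k * G₀′) + (y ^ suc (suc k) + suc (suc k) * suc y ^ suc k)
      ≡⟨ eq (suc k) x G₁ G₀′ (y ^ suc (suc k)) (suc y ^ suc k) ⟩
    suc (suc k) * x * G₁ + y ^ suc (suc k) + suc (suc k) * G₁′ ∎
  where
  open ≤-Reasoning
  G₁  = expSum x (suc k) y
  G₁′ = expSum x (suc k) (suc y)
  G₀′ = expSum x k (suc y)
  eq : ∀ k x G G′ p q → suc k * x * (G + k * G′) + (p + suc k * q)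
                       ≡ suc k * x * G + p + suc k * (k * x * G′ + q)
  eq = solve-∀

-- A truncated `exp((y + 1)/(x + 1)) ≤ (1 + 1/x) exp(y/(x + 1))`. The derivative of the truncated
-- series is, up to scaling, the series without its top term, so `expSum-convex` bounds the
-- increment by `1/(x + 1)` of the value at `y + 1`.
expSum-step : ∀ x k y → x * expSum (suc x) k (suc y) ≤ suc x * expSum (suc x) k y
expSum-step x zero    y = *-monoˡ-≤ 1 (n≤1+n x)
expSum-step x (suc k) y = +-cancelʳ-≤ G₁′ _ _ (begin
    x * G₁′ + G₁′                          ≡⟨ +-comm (x * G₁′) G₁′ ⟩
    suc x * G₁′                            ≤⟨ *-monoʳ-≤ (suc x) (expSum-convex (suc x) k y) ⟩
    suc x * (G₁ + suc k * G₀′)             ≡⟨ eq x k G₁ G₀′ ⟩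
    suc x * G₁ + suc k * suc x * G₀′       ≤⟨ +-monoʳ-≤ (suc x * G₁) (m≤m+n _ (suc y ^ suc k)) ⟩
    suc x * G₁ + G₁′                       ∎)
  where
  open ≤-Reasoning
  G₁  = expSum (suc x) (suc k) y
  G₁′ = expSum (suc x) (suc k) (suc y)
  G₀′ = expSum (suc x) k (suc y)
  eq : ∀ x k G G′ → suc x * (G + suc k * G′) ≡ suc x * G + suc k * suc x * G′
  eq = solve-∀

expSum-iterate : ∀ x k y → x ^ y * expSum (suc x) k y ≤ suc x ^ y * expSum (suc x) k 0
expSum-iterate x k zero    = ≤-refl
expSum-iterate x k (suc y) = begin
    x * x ^ y * expSum (suc x) k (suc y)   ≡⟨ eq x (x ^ y) (expSum (suc x) k (suc y)) ⟩
    x ^ y * (x * expSum (suc x) k (suc y)) ≤⟨ *-monoʳ-≤ (x ^ y) (expSum-step x k y) ⟩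
    x ^ y * (suc x * expSum (suc x) k y)   ≡⟨ eq (suc x) (x ^ y) (expSum (suc x) k y) ⟨
    suc x * x ^ y * expSum (suc x) k y     ≡⟨ *-assoc (suc x) (x ^ y) _ ⟩
    suc x * (x ^ y * expSum (suc x) k y)   ≤⟨ *-monoʳ-≤ (suc x) (expSum-iterate x k y) ⟩
    suc x * (suc x ^ y * expSum (suc x) k 0) ≡⟨ *-assoc (suc x) (suc x ^ y) _ ⟨
    suc x * suc x ^ y * expSum (suc x) k 0 ∎
  where
  open ≤-Reasoning
  eq : ∀ x p G → x * p * G ≡ p * (x * G)
  eq = solve-∀

expSum-zero : ∀ x k → expSum x k 0 ≡ k ! * x ^ k
expSum-zero x zero    = refl
expSum-zero x (suc k) = trans (cong (λ G → suc k * x * G + 0) (expSum-zero x k)) (eq k x (k !) (x ^ k))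
  where
  eq : ∀ k x f p → suc k * x * (f * p) + 0 ≡ suc k * f * (x * p)
  eq = solve-∀

expSum-diagonal : ∀ x k → expSum x k x ≡ S k * x ^ k
expSum-diagonal x zero    = refl
expSum-diagonal x (suc k) = trans (cong (λ G → suc k * x * G + x * x ^ k) (expSum-diagonal x k)) (eq k x (S k) (x ^ k))
  where
  eq : ∀ k x s p → suc k * x * (s * p) + x * p ≡ (suc k * s + 1) * (x * p)
  eq = solve-∀

-- The truncated series of `exp(y/(x + 1))` grows from 1 to `S k / k!` as `y` goes from 0 to
-- `x + 1`, and each of these `x + 1` unit steps costs at most the factor `1 + 1/x`.
S/k!≤[1+1/x]^[1+x] : ∀ x k → x ^ suc x * S k ≤ suc x ^ suc x * k !
S/k!≤[1+1/x]^[1+x] x k = *-cancelʳ-≤ _ _ (suc x ^ k) {{m^n≢0 (suc x) k}} (begin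
    x ^ suc x * S k * suc x ^ k             ≡⟨ *-assoc (x ^ suc x) (S k) _ ⟩
    x ^ suc x * (S k * suc x ^ k)           ≡⟨ cong (x ^ suc x *_) (expSum-diagonal (suc x) k) ⟨
    x ^ suc x * expSum (suc x) k (suc x)    ≤⟨ expSum-iterate x k (suc x) ⟩
    suc x ^ suc x * expSum (suc x) k 0      ≡⟨ cong (suc x ^ suc x *_) (expSum-zero (suc x) k) ⟩
    suc x ^ suc x * (k ! * suc x ^ k)       ≡⟨ *-assoc (suc x ^ suc x) (k !) _ ⟨
    suc x ^ suc x * k ! * suc x ^ k         ∎)
  where open ≤-Reasoning

-- Telescoping (1 + 1/x)ˣ⁺¹ over 1 ≤ x ≤ m: a form of Stirling's bound (m + 1)! ≲ ((m + 1)/e)ᵐ⁺¹.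
factorial-upper : ∀ k m → S k ^ m * suc m ! ≤ (k !) ^ m * suc m ^ (2 + m)
factorial-upper k zero    = ≤-refl
factorial-upper k (suc m) = begin
    s * s ^ m * (suc M * M !)                    ≡⟨ eq₁ s (s ^ m) (suc M) (M !) ⟩
    s * suc M * (s ^ m * M !)                    ≤⟨ *-monoʳ-≤ (s * suc M) (factorial-upper k m) ⟩
    s * suc M * (f ^ m * M ^ suc M)              ≡⟨ eq₂ s (suc M) (f ^ m) (M ^ suc M) ⟩
    suc M * f ^ m * (M ^ suc M * s)              ≤⟨ *-monoʳ-≤ (suc M * f ^ m) (S/k!≤[1+1/x]^[1+x] M k) ⟩
    suc M * f ^ m * (suc M ^ suc M * f)          ≡⟨ eq₃ (suc M) (f ^ m) (suc M ^ suc M) f ⟩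
    f * f ^ m * (suc M * suc M ^ suc M)          ∎
  where
  open ≤-Reasoning
  M = suc m
  s = S k
  f = k !
  eq₁ : ∀ s p M f → s * p * (M * f) ≡ s * M * (p * f)
  eq₁ = solve-∀
  eq₂ : ∀ s M p q → s * M * (p * q) ≡ M * p * (q * s)
  eq₂ = solve-∀
  eq₃ : ∀ M p q f → M * p * (q * f) ≡ f * p * (M * q)
  eq₃ = solve-∀

-- Eventual inequalities

2*m^m≤[1+m]^m : ∀ m → 0 < m → 2 * m ^ m ≤ suc m ^ m
2*m^m≤[1+m]^m m@(suc _) _ = *-cancelʳ-≤ _ _ m (begin
    2 * m ^ m * m       ≡⟨ eq m (m ^ m) ⟩
    m ^ m * (m + m)     ≤⟨ m^n*[m+n]≤[1+m]^n*m m m ⟩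
    suc m ^ m * m       ∎)
  where
  open ≤-Reasoning
  eq : ∀ m p → 2 * p * m ≡ p * (m + m)
  eq = solve-∀

1+n≤2^n : ∀ n → suc n ≤ 2 ^ n
1+n≤2^n zero    = ≤-refl
1+n≤2^n (suc n) = +-mono-≤ (≤-trans (s≤s z≤n) (1+n≤2^n n)) (≤-trans (1+n≤2^n n) (m≤m+n _ 0))

-- Every `u` factors `(u + 1)/u` at least double, so `m = u r` of them give at least `2ʳ`, while
-- `(m + 1)²` is only quadratic in `r`.
exponential-beats-quadratic : ∀ C u → 0 < u → Σ ℕ λ m → C * (suc m * suc m) * u ^ m < suc u ^ m
exponential-beats-quadratic C u 0<u = u * r , (begin-strict
    C * (suc (u * r) * suc (u * r)) * u ^ (u * r)
      ≤⟨ *-monoˡ-≤ (u ^ (u * r)) (*-monoʳ-≤ C (*-mono-≤ bound bound)) ⟩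
    C * (suc u * (4 * suc q) * (suc u * (4 * suc q))) * u ^ (u * r)
      ≡⟨ cong (_* u ^ (u * r)) (eq C (suc u) (suc q)) ⟩
    q * (suc q * suc q) * u ^ (u * r)
      <⟨ *-monoˡ-< (u ^ (u * r)) {{m^n≢0 u (u * r) {{>-nonZero 0<u}}}} (*-monoˡ-< (suc q * suc q) (≤-trans (n<1+n q) (m≤m*n (suc q) (suc q)))) ⟩
    suc q * suc q * (suc q * suc q) * u ^ (u * r)
      ≡⟨ cong (_* u ^ (u * r)) (eq′ (suc q)) ⟩
    suc q ^ 4 * u ^ (u * r)
      ≤⟨ *-monoˡ-≤ (u ^ (u * r)) (^-monoˡ-≤ 4 (1+n≤2^n q)) ⟩
    (2 ^ q) ^ 4 * u ^ (u * r)
      ≡⟨ cong₂ _*_ (^-*-assoc 2 q 4) (sym (^-*-assoc u u r)) ⟩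
    2 ^ r * (u ^ u) ^ r
      ≡⟨ ^-distribʳ-* 2 (u ^ u) r ⟨
    (2 * u ^ u) ^ r
      ≤⟨ ^-monoˡ-≤ r (2*m^m≤[1+m]^m u 0<u) ⟩
    (suc u ^ u) ^ r
      ≡⟨ ^-*-assoc (suc u) u r ⟩
    suc u ^ (u * r) ∎)
  where
  open ≤-Reasoning
  -- Chosen so that `C (m + 1)² ≤ q (q + 1)²`, which is below `(q + 1)⁴ ≤ 2 ^ (q * 4)`.
  q = 16 * C * (suc u * suc u)
  r = q * 4
  bound : suc (u * r) ≤ suc u * (4 * suc q)
  bound = ≤-trans (m≤m+n _ _) (≤-reflexive (eq u q))
    where
    eq : ∀ u q → suc (u * (q * 4)) + (u * 4 + 3 + 4 * q) ≡ suc u * (4 * suc q)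
    eq = solve-∀
  eq : ∀ C v p → C * (v * (4 * p) * (v * (4 * p))) ≡ 16 * C * (v * v) * (p * p)
  eq = solve-∀
  eq′ : ∀ p → p * p * (p * p) ≡ p * (p * (p * (p * 1)))
  eq′ = solve-∀

S-positive : ∀ k → 0 < S k
S-positive zero    = s≤s z≤n
S-positive (suc k) = m≤n+m 1 (suc k * S k)

-- The place where `a/b > e⁻²` enters. With `u = b (k!)²`, squaring `factorial-upper` reduces the
-- claim to `b T² uᵐ < (a (S k)²)ᵐ`. Since `a (S k)² ≥ u + 1` for integers, a geometric factor has
-- to beat a quadratic one.
factorial-below-power : ∀ a b k → 0 < b → b * (k ! * k !) < a * (S k * S k) →
  Σ ℕ λ m → let T = suc m in b ^ T * (T ! * T !) < a ^ T * (T * T) ^ T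
factorial-below-power zero b k _ ()
factorial-below-power a@(suc _) b k 0<b u<v =
  m , *-cancelʳ-< _ _ _ (begin-strict
    b ^ T * (T ! * T !) * (s * s) ^ m
      ≡⟨ cong (b ^ T * (T ! * T !) *_) (^-distribʳ-* s s m) ⟩
    b * b ^ m * (T ! * T !) * (s ^ m * s ^ m)
      ≡⟨ eq₁ (b ^ T) (T !) (s ^ m) ⟩
    b ^ T * (s ^ m * T ! * (s ^ m * T !))
      ≤⟨ *-monoʳ-≤ (b ^ T) (*-mono-≤ (factorial-upper k m) (factorial-upper k m)) ⟩
    b ^ T * (f ^ m * (T * T ^ T) * (f ^ m * (T * T ^ T)))
      ≡⟨ eq₂ b (b ^ m) (f ^ m) T (T ^ T) ⟩
    b * (T * T) * (b ^ m * (f ^ m * f ^ m)) * (T ^ T * T ^ T)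
      ≡⟨ cong₂ (λ x y → b * (T * T) * (b ^ m * x) * y) (^-distribʳ-* f f m) (^-distribʳ-* T T T) ⟨
    b * (T * T) * (b ^ m * (f * f) ^ m) * (T * T) ^ T
      ≡⟨ cong (λ x → b * (T * T) * x * (T * T) ^ T) (^-distribʳ-* b (f * f) m) ⟨
    b * (T * T) * u ^ m * (T * T) ^ T
      <⟨ *-monoˡ-< ((T * T) ^ T) {{m^n≢0 (T * T) T}} (proj₂ choice) ⟩
    suc u ^ m * (T * T) ^ T
      ≤⟨ *-monoˡ-≤ ((T * T) ^ T) (^-monoˡ-≤ m u<v) ⟩
    (a * (s * s)) ^ m * (T * T) ^ T
      ≡⟨ cong (_* (T * T) ^ T) (^-distribʳ-* a (s * s) m) ⟩
    a ^ m * (s * s) ^ m * (T * T) ^ T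
      ≤⟨ *-monoˡ-≤ ((T * T) ^ T) (*-monoˡ-≤ ((s * s) ^ m) (m≤n*m (a ^ m) a)) ⟩
    a ^ T * (s * s) ^ m * (T * T) ^ T
      ≡⟨ eq₃ (a ^ T) ((s * s) ^ m) ((T * T) ^ T) ⟩
    a ^ T * (T * T) ^ T * (s * s) ^ m ∎)
  where
  open ≤-Reasoning
  s = S k
  f = k !
  u = b * (f * f)
  0<u : 0 < u
  0<u = *-mono-≤ 0<b (*-mono-≤ (!-positive k) (!-positive k))
  choice = exponential-beats-quadratic b u 0<u
  m = proj₁ choice
  T = suc m
  eq₁ : ∀ b t s → b * (t * t) * (s * s) ≡ b * (s * t * (s * t))
  eq₁ = solve-∀
  eq₂ : ∀ b c f t p → b * c * (f * (t * p) * (f * (t * p))) ≡ b * (t * t) * (c * (f * f)) * (p * p)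
  eq₂ = solve-∀
  eq₃ : ∀ a s t → a * s * t ≡ a * t * s
  eq₃ = solve-∀

-- A telescoping product: `x` is at least each of `y, …, y + T - 1`, so every factor `1 + 1/x` is at
-- most the corresponding `1 + 1/(y + i)`, and these multiply to `(y + T)/y`.
[1+x]^T*y≤x^T*[y+T] : ∀ x T y → y + T ≤ x → suc x ^ T * y ≤ x ^ T * (y + T)
[1+x]^T*y≤x^T*[y+T] x zero    y _     = ≤-reflexive (cong (1 *_) (sym (+-identityʳ y)))
[1+x]^T*y≤x^T*[y+T] x (suc T) y y+T≤x = begin
    suc x * suc x ^ T * y            ≡⟨ eq₁ (suc x) (suc x ^ T) y ⟩
    suc x ^ T * (y + x * y)          ≤⟨ *-monoʳ-≤ (suc x ^ T) (+-monoˡ-≤ (x * y) (≤-trans (m≤m+n y (suc T)) y+T≤x)) ⟩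
    suc x ^ T * (x + x * y)          ≡⟨ eq₂ x y (suc x ^ T) ⟩
    x * (suc x ^ T * suc y)          ≤⟨ *-monoʳ-≤ x ([1+x]^T*y≤x^T*[y+T] x T (suc y) (≤-trans (≤-reflexive (sym (+-suc y T))) y+T≤x)) ⟩
    x * (x ^ T * (suc y + T))        ≡⟨ *-assoc x (x ^ T) (suc y + T) ⟨
    x * x ^ T * (suc y + T)          ≡⟨ cong (x * x ^ T *_) (+-suc y T) ⟨
    x * x ^ T * (y + suc T)          ∎
  where
  open ≤-Reasoning
  eq₁ : ∀ s p y → s * p * y ≡ p * (s * y)
  eq₁ = solve-∀
  eq₂ : ∀ x y p → p * (x + x * y) ≡ x * (p * suc y)
  eq₂ = solve-∀

-- The shift by `K` costs the factor `(1 + K/n)ᵀ`, which tends to 1 and is absorbed by the strict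
-- inequality `A < B`.
shifted-power-eventually : ∀ T A B K → 0 < T → A < B →
  Σ ℕ λ N → ∀ n → N ≤ n → (n + K) ^ T * A ≤ n ^ T * B
shifted-power-eventually T@(suc _) A B K _ A<B = K * x , λ n N≤n →
  *-cancelʳ-≤ _ _ (x ^ T) {{m^n≢0 x T}} (begin
    (n + K) ^ T * A * x ^ T      ≡⟨ eq₁ ((n + K) ^ T) A (x ^ T) ⟩
    (n + K) ^ T * x ^ T * A      ≡⟨ cong (_* A) (^-distribʳ-* (n + K) x T) ⟨
    ((n + K) * x) ^ T * A        ≤⟨ *-monoˡ-≤ A (^-monoˡ-≤ T (scale n N≤n)) ⟩
    (n * suc x) ^ T * A          ≡⟨ cong (_* A) (^-distribʳ-* n (suc x) T) ⟩
    n ^ T * suc x ^ T * A        ≡⟨ *-assoc (n ^ T) (suc x ^ T) A ⟩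
    n ^ T * (suc x ^ T * A)      ≤⟨ *-monoʳ-≤ (n ^ T) key ⟩
    n ^ T * (x ^ T * suc A)      ≤⟨ *-monoʳ-≤ (n ^ T) (*-monoʳ-≤ (x ^ T) A<B) ⟩
    n ^ T * (x ^ T * B)          ≡⟨ eq₂ (n ^ T) (x ^ T) B ⟩
    n ^ T * B * x ^ T            ∎)
  where
  open ≤-Reasoning
  -- For `n ≥ K x` one has `(n + K) x ≤ n (x + 1)`. With `y = A T` this `x` is `y + T`, so
  -- `[1+x]^T*y≤x^T*[y+T]` bounds `(1 + 1/x)ᵀ` by `(A + 1)/A`.
  x = suc A * T
  eq₁ : ∀ p a q → p * a * q ≡ p * q * a
  eq₁ = solve-∀
  eq₂ : ∀ p q b → p * (q * b) ≡ p * b * q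
  eq₂ = solve-∀
  scale : ∀ n → K * x ≤ n → (n + K) * x ≤ n * suc x
  scale n Kx≤n = begin
    (n + K) * x     ≡⟨ *-distribʳ-+ x n K ⟩
    n * x + K * x   ≤⟨ +-monoʳ-≤ (n * x) Kx≤n ⟩
    n * x + n       ≡⟨ +-comm (n * x) n ⟩
    n + n * x       ≡⟨ *-suc n x ⟨
    n * suc x       ∎
  key : suc x ^ T * A ≤ x ^ T * suc A
  key = *-cancelʳ-≤ _ _ T (begin
    suc x ^ T * A * T         ≡⟨ *-assoc (suc x ^ T) A T ⟩
    suc x ^ T * (A * T)       ≤⟨ [1+x]^T*y≤x^T*[y+T] x T (A * T) (≤-reflexive (+-comm (A * T) T)) ⟩
    x ^ T * (A * T + T)       ≡⟨ cong (x ^ T *_) (+-comm (A * T) T) ⟩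
    x ^ T * (suc A * T)       ≡⟨ *-assoc (x ^ T) (suc A) T ⟨
    x ^ T * suc A * T         ∎)

-- Passes from `m` edges to the exponent `n²`. Squaring the colouring bound gives the exponent
-- `2 m`, the defect `d = n² - 2 m` is filled with factors `R ≤ P`, then `small` is raised to the
-- power `n²` and a `T`-th root is taken.
n²-power-bound : ∀ a b T n m F → 0 < T → 2 * m ≤ n * n →
  b ^ T * (T ! * T !) * (n + T * T) ^ T ≤ n ^ T * (a ^ T * (T * T) ^ T) →
  F ^ T * ((T * T) ^ T) ^ m ≤ (T ! * T ! * (n + T * T) ^ T) ^ m →
  b ^ (n * n) * (F * F) ≤ (a * n) ^ (n * n)
n²-power-bound a b T@(suc _) n m F 0<T 2m≤n² small bound =
  ^-cancelˡ-≤ T 0<T (*-cancelʳ-≤ _ _ (R ^ q) {{m^n≢0 R q {{m^n≢0 K T}}}} (begin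
    (b ^ q * (F * F)) ^ T * R ^ q          ≡⟨ cong (_* R ^ q) (^-distribʳ-* (b ^ q) (F * F) T) ⟩
    (b ^ q) ^ T * (F * F) ^ T * R ^ q      ≡⟨ *-assoc ((b ^ q) ^ T) ((F * F) ^ T) (R ^ q) ⟩
    (b ^ q) ^ T * ((F * F) ^ T * R ^ q)    ≤⟨ *-monoʳ-≤ ((b ^ q) ^ T) squared ⟩
    (b ^ q) ^ T * P ^ q                    ≡⟨ cong (_* P ^ q) (^-comm b q T) ⟩
    (b ^ T) ^ q * P ^ q                    ≡⟨ ^-distribʳ-* (b ^ T) P q ⟨
    (b ^ T * P) ^ q                        ≡⟨ cong (_^ q) (*-assoc (b ^ T) (T ! * T !) ((n + K) ^ T)) ⟨
    (b ^ T * (T ! * T !) * (n + K) ^ T) ^ q ≤⟨ ^-monoˡ-≤ q small ⟩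
    (n ^ T * (a ^ T * R)) ^ q              ≡⟨ cong (_^ q) (eq (n ^ T) (a ^ T) R) ⟩
    (a ^ T * n ^ T * R) ^ q                ≡⟨ cong (λ z → (z * R) ^ q) (^-distribʳ-* a n T) ⟨
    ((a * n) ^ T * R) ^ q                  ≡⟨ ^-distribʳ-* ((a * n) ^ T) R q ⟩
    ((a * n) ^ T) ^ q * R ^ q              ≡⟨ cong (_* R ^ q) (^-comm (a * n) T q) ⟩
    ((a * n) ^ q) ^ T * R ^ q              ∎))
  where
  open ≤-Reasoning
  q = n * n
  K = T * T
  R = K ^ T
  P = T ! * T ! * (n + K) ^ T
  eq : ∀ p s r → p * (s * r) ≡ s * p * r
  eq = solve-∀
  R≤P : R ≤ P
  R≤P = ≤-trans (^-monoˡ-≤ T (m≤n+m K n)) (m≤n*m ((n + K) ^ T) (T ! * T !) {{>-nonZero (*-mono-≤ (!-positive T) (!-positive T))}})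
  squared : (F * F) ^ T * R ^ q ≤ P ^ q
  squared with d , 2m+d≡q ← m≤n⇒∃[o]m+o≡n 2m≤n² = begin
    (F * F) ^ T * R ^ q                    ≡⟨ cong₂ _*_ (^-distribʳ-* F F T) (split R) ⟩
    F ^ T * F ^ T * (R ^ m * R ^ m * R ^ d) ≡⟨ eq′ (F ^ T) (R ^ m) (R ^ d) ⟩
    F ^ T * R ^ m * (F ^ T * R ^ m) * R ^ d ≤⟨ *-mono-≤ (*-mono-≤ bound bound) (^-monoˡ-≤ d R≤P) ⟩
    P ^ m * P ^ m * P ^ d                  ≡⟨ split P ⟨
    P ^ q                                  ∎
    where
    eq′ : ∀ f r s → f * f * (r * r * s) ≡ f * r * (f * r) * s
    eq′ = solve-∀
    split : ∀ x → x ^ q ≡ x ^ m * x ^ m * x ^ d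
    split x = trans (cong (x ^_) (sym 2m+d≡q)) (trans (^-distribˡ-+-* x (2 * m) d)
      (cong (_* x ^ d) (trans (cong (x ^_) (cong (m +_) (+-identityʳ m))) (^-distribˡ-+-* x m m))))

-- Finite sums and products

private variable
  A B : Set

module BigOp {_∙_ : ℕ → ℕ → ℕ} {ε : ℕ} (isCM : IsCommutativeMonoid _≡_ _∙_ ε) where
  open IsCommutativeMonoid isCM using (assoc; comm; identityˡ; identityʳ)
  open ≡-Reasoning

  ⨁ : List A → (A → ℕ) → ℕ
  ⨁ []       f = ε
  ⨁ (x ∷ xs) f = f x ∙ ⨁ xs f

  ⨁-cong : ∀ {f g : A → ℕ} xs → (∀ x → x ∈ xs → f x ≡ g x) → ⨁ xs f ≡ ⨁ xs g
  ⨁-cong []       f≗g = refl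
  ⨁-cong (x ∷ xs) f≗g = cong₂ _∙_ (f≗g x (here refl)) (⨁-cong xs (λ y y∈xs → f≗g y (there y∈xs)))

  interchange : ∀ a b c d → (a ∙ b) ∙ (c ∙ d) ≡ (a ∙ c) ∙ (b ∙ d)
  interchange a b c d = begin
    (a ∙ b) ∙ (c ∙ d)  ≡⟨ assoc a b (c ∙ d) ⟩
    a ∙ (b ∙ (c ∙ d))  ≡⟨ cong (a ∙_) (assoc b c d) ⟨
    a ∙ ((b ∙ c) ∙ d)  ≡⟨ cong (λ z → a ∙ (z ∙ d)) (comm b c) ⟩
    a ∙ ((c ∙ b) ∙ d)  ≡⟨ cong (a ∙_) (assoc c b d) ⟩
    a ∙ (c ∙ (b ∙ d))  ≡⟨ assoc a c (b ∙ d) ⟨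
    (a ∙ c) ∙ (b ∙ d)  ∎

  ⨁-∙ : ∀ (f g : A → ℕ) xs → ⨁ xs (λ x → f x ∙ g x) ≡ ⨁ xs f ∙ ⨁ xs g
  ⨁-∙ f g []       = sym (identityˡ ε)
  ⨁-∙ f g (x ∷ xs) = trans (cong (_ ∙_) (⨁-∙ f g xs)) (interchange (f x) (g x) (⨁ xs f) (⨁ xs g))

  ⨁-ε : ∀ (xs : List A) → ⨁ xs (λ _ → ε) ≡ ε
  ⨁-ε []       = refl
  ⨁-ε (x ∷ xs) = trans (identityˡ _) (⨁-ε xs)

  ⨁-comm : ∀ (f : A → B → ℕ) xs ys → ⨁ xs (λ x → ⨁ ys (f x)) ≡ ⨁ ys (λ y → ⨁ xs (λ x → f x y))
  ⨁-comm f []       ys = sym (⨁-ε ys)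
  ⨁-comm f (x ∷ xs) ys = trans (cong (_ ∙_) (⨁-comm f xs ys)) (sym (⨁-∙ (f x) (λ y → ⨁ xs (λ x → f x y)) ys))

  ⨁-++ : ∀ (f : A → ℕ) xs ys → ⨁ (xs ++ ys) f ≡ ⨁ xs f ∙ ⨁ ys f
  ⨁-++ f []       ys = sym (identityˡ _)
  ⨁-++ f (x ∷ xs) ys = trans (cong (f x ∙_) (⨁-++ f xs ys)) (sym (assoc (f x) _ _))

  ⨁-map : ∀ (f : B → ℕ) (h : A → B) xs → ⨁ (map h xs) f ≡ ⨁ xs (f ∘ h)
  ⨁-map f h []       = refl
  ⨁-map f h (x ∷ xs) = cong (f (h x) ∙_) (⨁-map f h xs)

  ⨁-concatMap : ∀ (f : B → ℕ) (h : A → List B) xs → ⨁ (concatMap h xs) f ≡ ⨁ xs (λ x → ⨁ (h x) f)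
  ⨁-concatMap f h []       = refl
  ⨁-concatMap f h (x ∷ xs) = trans (⨁-++ f (h x) (concatMap h xs)) (cong (⨁ (h x) f ∙_) (⨁-concatMap f h xs))

  ⨁-↭ : ∀ (f : A → ℕ) {xs ys} → xs ↭ ys → ⨁ xs f ≡ ⨁ ys f
  ⨁-↭ f Perm.refl         = refl
  ⨁-↭ f (Perm.prep x p)   = cong (f x ∙_) (⨁-↭ f p)
  ⨁-↭ f (Perm.swap {xs} {ys} x y p) = begin
    f x ∙ (f y ∙ ⨁ xs f)  ≡⟨ assoc (f x) (f y) _ ⟨
    (f x ∙ f y) ∙ ⨁ xs f  ≡⟨ cong₂ _∙_ (comm (f x) (f y)) (⨁-↭ f p) ⟩
    (f y ∙ f x) ∙ ⨁ ys f  ≡⟨ assoc (f y) (f x) _ ⟩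
    f y ∙ (f x ∙ ⨁ ys f)  ∎
  ⨁-↭ f (Perm.trans p q)  = trans (⨁-↭ f p) (⨁-↭ f q)

  ⨁-filter : ∀ {P : Pred A 0ℓ} (P? : Decidable P) (f : A → ℕ) xs →
    ⨁ (filter P? xs) f ≡ ⨁ xs (λ x → if does (P? x) then f x else ε)
  ⨁-filter P? f []       = refl
  ⨁-filter P? f (x ∷ xs) with does (P? x)
  ... | true  = cong (f x ∙_) (⨁-filter P? f xs)
  ... | false = trans (⨁-filter P? f xs) (sym (identityˡ _))

  ⨁-allFin-suc : ∀ n (f : Fin (suc n) → ℕ) → ⨁ (allFin (suc n)) f ≡ f zero ∙ ⨁ (allFin n) (f ∘ suc)
  ⨁-allFin-suc n f = cong (f zero ∙_)
    (trans (cong (λ xs → ⨁ xs f) (sym (List.map-tabulate (λ i → i) suc))) (⨁-map f suc (allFin n)))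

  ⨁-single : ∀ n (i : Fin n) (v : ℕ) → ⨁ (allFin n) (λ j → if does (i Fin.≟ j) then v else ε) ≡ v
  ⨁-single (suc n) zero    v = trans (⨁-allFin-suc n _) (trans (cong (v ∙_) (⨁-ε (allFin n))) (identityʳ v))
  ⨁-single (suc n) (suc i) v = trans (⨁-allFin-suc n _) (trans (identityˡ _) (⨁-single n i v))

  -- Each `f x` is spread over all `i`, with the neutral element everywhere except at `i = h x`;
  -- exchanging the two operations collects the fibres. It serves for sums over colours and for
  -- products over times.
  ⨁-fibres : ∀ n (h : A → Fin n) (f : A → ℕ) xs →
    ⨁ xs f ≡ ⨁ (allFin n) (λ i → ⨁ (filter (λ x → h x Fin.≟ i) xs) f)
  ⨁-fibres n h f xs = begin
    ⨁ xs f
      ≡⟨ ⨁-cong xs (λ x _ → ⨁-single n (h x) (f x)) ⟨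
    ⨁ xs (λ x → ⨁ (allFin n) (λ i → if does (h x Fin.≟ i) then f x else ε))
      ≡⟨ ⨁-comm _ xs (allFin n) ⟩
    ⨁ (allFin n) (λ i → ⨁ xs (λ x → if does (h x Fin.≟ i) then f x else ε))
      ≡⟨ ⨁-cong (allFin n) (λ i _ → ⨁-filter (λ x → h x Fin.≟ i) f xs) ⟨
    ⨁ (allFin n) (λ i → ⨁ (filter (λ x → h x Fin.≟ i) xs) f) ∎

module Sum = BigOp +-0-isCommutativeMonoid
module Prod = BigOp *-1-isCommutativeMonoid
open Sum using () renaming (⨁ to ∑)
open Prod using () renaming (⨁ to ∏)

∑-mono : ∀ {f g : A → ℕ} xs → (∀ x → x ∈ xs → f x ≤ g x) → ∑ xs f ≤ ∑ xs g
∑-mono []       f≤g = z≤n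
∑-mono (x ∷ xs) f≤g = +-mono-≤ (f≤g x (here refl)) (∑-mono xs (λ y y∈xs → f≤g y (there y∈xs)))

∏-mono : ∀ {f g : A → ℕ} xs → (∀ x → x ∈ xs → f x ≤ g x) → ∏ xs f ≤ ∏ xs g
∏-mono []       f≤g = ≤-refl
∏-mono (x ∷ xs) f≤g = *-mono-≤ (f≤g x (here refl)) (∏-mono xs (λ y y∈xs → f≤g y (there y∈xs)))

length-allFin : ∀ n → length (allFin n) ≡ n
length-allFin n = List.length-tabulate {n = n} (λ i → i)

∑-const : ∀ c (xs : List A) → ∑ xs (λ _ → c) ≡ length xs * c
∑-const c []       = refl
∑-const c (x ∷ xs) = cong (c +_) (∑-const c xs)

∏-const : ∀ c (xs : List A) → ∏ xs (λ _ → c) ≡ c ^ length xs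
∏-const c []       = refl
∏-const c (x ∷ xs) = cong (c *_) (∏-const c xs)

*-distribˡ-∑ : ∀ c (f : A → ℕ) xs → c * ∑ xs f ≡ ∑ xs (λ x → c * f x)
*-distribˡ-∑ c f []       = *-zeroʳ c
*-distribˡ-∑ c f (x ∷ xs) = trans (*-distribˡ-+ c (f x) (∑ xs f)) (cong (c * f x +_) (*-distribˡ-∑ c f xs))

^-distribʳ-∏ : ∀ c (f : A → ℕ) xs → ∏ xs f ^ c ≡ ∏ xs (λ x → f x ^ c)
^-distribʳ-∏ c f []       = ^-zeroˡ c
^-distribʳ-∏ c f (x ∷ xs) = trans (^-distribʳ-* (f x) (∏ xs f) c) (cong (f x ^ c *_) (^-distribʳ-∏ c f xs))

∏-positive : ∀ (f : A → ℕ) xs → (∀ x → x ∈ xs → 0 < f x) → 0 < ∏ xs f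
∏-positive f xs 0<f = ≤-trans (≤-reflexive (sym (Prod.⨁-ε xs))) (∏-mono xs 0<f)

-- The induction hypothesis bounds the product `p` of all terms but one by its value when they all
-- equal `s / n`, and `am-gm-step` settles that case. The empty list is covered by `0 ^ 0 = 1`.
am-gm : ∀ (f : A → ℕ) xs → ∏ xs f * length xs ^ length xs ≤ ∑ xs f ^ length xs
am-gm f []       = ≤-refl
am-gm f (x ∷ xs) with length xs | ∑ xs f | ∏ xs f | am-gm f xs
... | zero  | s | p | ih = begin
    f x * p * 1      ≡⟨ *-identityʳ (f x * p) ⟩
    f x * p          ≡⟨ cong (f x *_) (*-identityʳ p) ⟨
    f x * (p * 1)    ≤⟨ *-monoʳ-≤ (f x) ih ⟩
    f x * 1          ≤⟨ *-monoˡ-≤ 1 (m≤m+n (f x) s) ⟩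
    (f x + s) * 1    ∎
  where open ≤-Reasoning
... | n@(suc _) | s | p | ih = *-cancelˡ-≤ (n ^ n) {{m^n≢0 n n}} (begin
    n ^ n * (f x * p * suc n ^ suc n)    ≡⟨ eq (n ^ n) (f x) p (suc n ^ suc n) ⟩
    p * n ^ n * (f x * suc n ^ suc n)    ≤⟨ *-monoˡ-≤ (f x * suc n ^ suc n) ih ⟩
    s ^ n * (f x * suc n ^ suc n)        ≡⟨ *-assoc (s ^ n) (f x) (suc n ^ suc n) ⟨
    s ^ n * f x * suc n ^ suc n          ≤⟨ am-gm-step n s (f x) ⟩
    n ^ n * (s + f x) ^ suc n            ≡⟨ cong (λ z → n ^ n * z ^ suc n) (+-comm s (f x)) ⟩
    n ^ n * (f x + s) ^ suc n            ∎)
  where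
  open ≤-Reasoning
  eq : ∀ q x p r → q * (x * p * r) ≡ p * q * (x * r)
  eq = solve-∀

⟦_⟧ : ∀ {P : Set} → Dec P → ℕ
⟦ P? ⟧ = if does P? then 1 else 0

⟦⟧≤1 : ∀ {P : Set} (P? : Dec P) → ⟦ P? ⟧ ≤ 1
⟦⟧≤1 (yes _) = ≤-refl
⟦⟧≤1 (no _)  = z≤n

⟦⟧-true : ∀ {P : Set} (P? : Dec P) → P → ⟦ P? ⟧ ≡ 1
⟦⟧-true P? p = cong (λ b → if b then 1 else 0) (dec-true P? p)

⟦⟧-false : ∀ {P : Set} (P? : Dec P) → ¬ P → ⟦ P? ⟧ ≡ 0
⟦⟧-false P? ¬p = cong (λ b → if b then 1 else 0) (dec-false P? ¬p)

⟦⟧-mono : ∀ {P Q : Set} (P? : Dec P) (Q? : Dec Q) → (P → Q) → ⟦ P? ⟧ ≤ ⟦ Q? ⟧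
⟦⟧-mono (yes p) Q? P⇒Q = ≤-reflexive (sym (⟦⟧-true Q? (P⇒Q p)))
⟦⟧-mono (no _)  Q? P⇒Q = z≤n

∑-filter : ∀ {P : Pred A 0ℓ} (P? : Decidable P) (f : A → ℕ) xs →
  ∑ (filter P? xs) f ≡ ∑ xs (λ x → ⟦ P? x ⟧ * f x)
∑-filter P? f xs = trans (Sum.⨁-filter P? f xs) (Sum.⨁-cong xs (λ x _ → lemma x))
  where
  lemma : ∀ x → (if does (P? x) then f x else 0) ≡ ⟦ P? x ⟧ * f x
  lemma x with does (P? x)
  ... | true  = sym (+-identityʳ (f x))
  ... | false = refl

-- Sums over vectors of independent times.

length-allVecs : ∀ T m → length (allVecs T m) ≡ T ^ m
length-allVecs T zero    = refl
length-allVecs T (suc m) = begin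
    length (allVecs T (suc m))                   ≡⟨ *-identityʳ _ ⟨
    length (allVecs T (suc m)) * 1               ≡⟨ ∑-const 1 (allVecs T (suc m)) ⟨
    ∑ (allVecs T (suc m)) (λ _ → 1)              ≡⟨ Sum.⨁-concatMap (λ _ → 1) _ (allFin T) ⟩
    ∑ (allFin T) (λ x → ∑ (map (x Vec.∷_) (allVecs T m)) (λ _ → 1))
                                                 ≡⟨ Sum.⨁-cong (allFin T) (λ x _ → fibre x) ⟩
    ∑ (allFin T) (λ _ → T ^ m)                   ≡⟨ ∑-const (T ^ m) (allFin T) ⟩
    length (allFin T) * T ^ m                    ≡⟨ cong (_* T ^ m) (length-allFin T) ⟩
    T * T ^ m                                    ∎
  where
  open ≡-Reasoning
  fibre : ∀ x → ∑ (map (x Vec.∷_) (allVecs T m)) (λ _ → 1) ≡ T ^ m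
  fibre x = begin
    ∑ (map (x Vec.∷_) (allVecs T m)) (λ _ → 1)   ≡⟨ Sum.⨁-map (λ _ → 1) (x Vec.∷_) (allVecs T m) ⟩
    ∑ (allVecs T m) (λ _ → 1)                    ≡⟨ ∑-const 1 (allVecs T m) ⟩
    length (allVecs T m) * 1                     ≡⟨ *-identityʳ _ ⟩
    length (allVecs T m)                         ≡⟨ length-allVecs T m ⟩
    T ^ m                                        ∎

∑-allVecs-suc : ∀ T m (f : Vec (Fin T) (suc m) → ℕ) →
  ∑ (allVecs T (suc m)) f ≡ ∑ (allFin T) (λ x → ∑ (allVecs T m) (λ τ → f (x Vec.∷ τ)))
∑-allVecs-suc T m f = trans (Sum.⨁-concatMap f _ (allFin T))
  (Sum.⨁-cong (allFin T) (λ x _ → Sum.⨁-map f (x Vec.∷_) (allVecs T m)))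

-- Divided by `T * T ^ m`, this is the product rule for means: for uniform times, coordinate `e` is
-- independent of any `h` that ignores it, which is expressed by invariance under overwriting that
-- coordinate.
∑-independent : ∀ T m (e : Fin m) (α : Fin T → ℕ) (h : Vec (Fin T) m → ℕ) →
  (∀ τ x → h (τ [ e ]≔ x) ≡ h τ) →
  T * ∑ (allVecs T m) (λ τ → α (lookup τ e) * h τ) ≡ ∑ (allFin T) α * ∑ (allVecs T m) h
∑-independent zero    (suc m) e α h h-indep = refl
∑-independent T@(suc _) (suc m) zero α h h-indep = begin
    T * ∑ (allVecs T (suc m)) (λ τ → α (lookup τ zero) * h τ)
      ≡⟨ cong (T *_) (∑-allVecs-suc T m _) ⟩
    T * ∑ (allFin T) (λ x → ∑ (allVecs T m) (λ τ → α x * h (x Vec.∷ τ)))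
      ≡⟨ cong (T *_) (Sum.⨁-cong (allFin T) (λ x _ → trans (sym (*-distribˡ-∑ (α x) _ (allVecs T m)))
           (trans (cong (α x *_) (H-const x)) (*-comm (α x) H)))) ⟩
    T * ∑ (allFin T) (λ x → H * α x)
      ≡⟨ cong (T *_) (*-distribˡ-∑ H α (allFin T)) ⟨
    T * (H * ∑ (allFin T) α)
      ≡⟨ eq T H (∑ (allFin T) α) ⟩
    ∑ (allFin T) α * (T * H)
      ≡⟨ cong (λ z → ∑ (allFin T) α * (z * H)) (length-allFin T) ⟨
    ∑ (allFin T) α * (length (allFin T) * H)
      ≡⟨ cong (∑ (allFin T) α *_) (∑-const H (allFin T)) ⟨
    ∑ (allFin T) α * ∑ (allFin T) (λ _ → H)
      ≡⟨ cong (∑ (allFin T) α *_) (trans (∑-allVecs-suc T m h) (Sum.⨁-cong (allFin T) (λ x _ → H-const x))) ⟨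
    ∑ (allFin T) α * ∑ (allVecs T (suc m)) h ∎
  where
  open ≡-Reasoning
  H = ∑ (allVecs T m) (λ τ → h (zero Vec.∷ τ))
  H-const : ∀ x → ∑ (allVecs T m) (λ τ → h (x Vec.∷ τ)) ≡ H
  H-const x = Sum.⨁-cong (allVecs T m) (λ τ _ → sym (h-indep (x Vec.∷ τ) zero))
  eq : ∀ t h a → t * (h * a) ≡ a * (t * h)
  eq = solve-∀
∑-independent T@(suc _) (suc m) (suc e) α h h-indep = begin
    T * ∑ (allVecs T (suc m)) (λ τ → α (lookup τ (suc e)) * h τ)
      ≡⟨ cong (T *_) (∑-allVecs-suc T m _) ⟩
    T * ∑ (allFin T) (λ x → ∑ (allVecs T m) (λ τ → α (lookup τ e) * h (x Vec.∷ τ)))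
      ≡⟨ *-distribˡ-∑ T _ (allFin T) ⟩
    ∑ (allFin T) (λ x → T * ∑ (allVecs T m) (λ τ → α (lookup τ e) * h (x Vec.∷ τ)))
      ≡⟨ Sum.⨁-cong (allFin T) (λ x _ → ∑-independent T m e α (λ τ → h (x Vec.∷ τ)) (λ τ y → h-indep (x Vec.∷ τ) y)) ⟩
    ∑ (allFin T) (λ x → ∑ (allFin T) α * ∑ (allVecs T m) (λ τ → h (x Vec.∷ τ)))
      ≡⟨ *-distribˡ-∑ (∑ (allFin T) α) _ (allFin T) ⟨
    ∑ (allFin T) α * ∑ (allFin T) (λ x → ∑ (allVecs T m) (λ τ → h (x Vec.∷ τ)))
      ≡⟨ cong (∑ (allFin T) α *_) (∑-allVecs-suc T m h) ⟨
    ∑ (allFin T) α * ∑ (allVecs T (suc m)) h ∎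
  where open ≡-Reasoning

∑-∸ : ∀ T (t : Fin T) → ∑ (allFin T) (λ x → ⟦ ¬? (toℕ x <? toℕ t) ⟧) ≡ T ∸ toℕ t
∑-∸ (suc T) zero    = begin
    ∑ (allFin (suc T)) (λ x → 1)       ≡⟨ ∑-const 1 (allFin (suc T)) ⟩
    length (allFin (suc T)) * 1        ≡⟨ *-identityʳ _ ⟩
    length (allFin (suc T))            ≡⟨ length-allFin (suc T) ⟩
    suc T                              ∎
  where open ≡-Reasoning
∑-∸ (suc T) (suc t) = trans (Sum.⨁-allFin-suc T (λ x → ⟦ ¬? (toℕ x <? toℕ (suc t)) ⟧)) (∑-∸ T t)

-- This is how the factorial enters: the numbers `s = T - t` run through `T, …, 1`.
∏-∸ : ∀ T → ∏ (allFin T) (λ t → T ∸ toℕ t) ≡ T !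
∏-∸ zero    = refl
∏-∸ (suc T) = trans (Prod.⨁-allFin-suc T (λ t → suc T ∸ toℕ t)) (cong (suc T *_) (∏-∸ T))

-- Random greedy colouring

-- `k!` times the probability `1 / j`: the number of choices at an edge lies between 1 and `k`, so
-- `k!` is a common denominator. The value at `j = 0` is a mere default.
cofactor : ℕ → ℕ → ℕ
cofactor k zero    = 0
cofactor k (suc j) = k ! / suc j

cofactor-* : ∀ {k j} → 0 < j → j ≤ k → cofactor k j * j ≡ k !
cofactor-* {k} {suc j} _ j≤k = m/n*n≡m (∣-trans (m∣m*n (j !)) (m≤n⇒m!∣n! j≤k))

≗⇒≡ : ∀ {k m} (X Y : Vec (Fin k) m) → (∀ f → lookup X f ≡ lookup Y f) → X ≡ Y
≗⇒≡ X Y X≗Y = trans (sym (tabulate∘lookup X)) (trans (tabulate-cong X≗Y) (tabulate∘lookup Y))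

module ConflictColoring {k m : ℕ} {Adj : Fin m → Fin m → Set} (adj? : ∀ e f → Dec (Adj e f)) where

  Col : Set
  Col = Vec (Fin k) m

  ProperCol : Col → Set
  ProperCol X = ∀ p q → ¬ (p ≡ q) → Adj p q → ¬ (lookup X p ≡ lookup X q)

  module _ {T : ℕ} (τ : Vec (Fin T) m) where

    time : Fin m → ℕ
    time e = toℕ (lookup τ e)

    -- Edges with equal times do not block each other. A greedy run may then give them conflicting
    -- colours, which can only lower the total probability of the proper colourings.
    Available : Col → Fin m → Fin k → Set
    Available X e c = ∀ f → Adj e f → time f < time e → lookup X f ≢ c

    abstract
      available? : ∀ X e c → Dec (Available X e c)
      available? X e c = Fin.all? λ f → adj? e f →-dec (time f <? time e →-dec ¬? (lookup X f Fin.≟ c))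

    choices : Col → Fin m → ℕ
    choices X e = ∑ (allFin k) (λ c → ⟦ available? X e c ⟧)

    available-own : ∀ {X} → ProperCol X → ∀ e → Available X e (lookup X e)
    available-own proper e f adj τf<τe eq = proper e f e≢f adj (sym eq)
      where
      e≢f : e ≢ f
      e≢f refl = <-irrefl refl τf<τe

    choices-positive : ∀ {X} → ProperCol X → ∀ e → 0 < choices X e
    choices-positive {X} proper e = ≤-trans (≤-reflexive (sym (Sum.⨁-single k (lookup X e) 1)))
      (∑-mono (allFin k) λ c _ → ⟦⟧-mono (lookup X e Fin.≟ c) (available? X e c) λ { refl → available-own {X} proper e })

    choices≤k : ∀ X e → choices X e ≤ k
    choices≤k X e = begin
      choices X e                ≤⟨ ∑-mono (allFin k) (λ c _ → ⟦⟧≤1 (available? X e c)) ⟩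
      ∑ (allFin k) (λ _ → 1)     ≡⟨ ∑-const 1 (allFin k) ⟩
      length (allFin k) * 1      ≡⟨ *-identityʳ _ ⟩
      length (allFin k)          ≡⟨ length-allFin k ⟩
      k                          ∎
      where open ≤-Reasoning

    -- k! times the probability that, in the random greedy colouring in the order of τ,
    -- edge e receives its colour in X given that all earlier edges did.
    weight : Col → Fin m → ℕ
    weight X e = cofactor k (choices X e)

    choices-cong : ∀ X Y e → (∀ f → time f < time e → lookup X f ≡ lookup Y f) → choices X e ≡ choices Y e
    choices-cong X Y e agree = Sum.⨁-cong (allFin k) λ c _ → ≤-antisym
      (⟦⟧-mono (available? X e c) (available? Y e c) λ av f adj f<e eq → av f adj f<e (trans (agree f f<e) eq))
      (⟦⟧-mono (available? Y e c) (available? X e c) λ av f adj f<e eq → av f adj f<e (trans (sym (agree f f<e)) eq))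

    Agree : List Col → Fin m → Set
    Agree L f = ∀ {X Y} → X ∈ L → Y ∈ L → lookup X f ≡ lookup Y f

    -- Probabilities add up to at most 1, scaled by `k!` per remaining edge. The induction follows
    -- the greedy run: `es` are the edges still to be coloured, and the members of `L` agree on all
    -- others. Splitting `L` by the colour of the next edge `e` leaves at most `choices` nonempty
    -- classes, and the weight of `e` cancels their number.
    ∑-weights : ∀ es → AllPairs (λ e f → time e ≤ time f) es →
      ∀ L → Unique L → (∀ {X} → X ∈ L → ProperCol X) → (∀ f → f ∈ es ⊎ Agree L f) →
      ∑ L (λ X → ∏ es (weight X)) ≤ (k !) ^ length es
    ∑-weights [] _ [] _ _ _ = z≤n
    ∑-weights [] _ (X ∷ []) _ _ _ = ≤-refl
    -- With no edges left, all members of `L` coincide, so distinctness leaves at most one.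
    ∑-weights [] _ (X ∷ Y ∷ L) ((X≢Y ∷ _) ∷ _) _ agree =
      contradiction (≗⇒≡ X Y (λ f → agree′ f (agree f))) X≢Y
      where
      agree′ : ∀ f → f ∈ [] ⊎ Agree (X ∷ Y ∷ L) f → lookup X f ≡ lookup Y f
      agree′ f (inj₂ eq) = eq (here refl) (there (here refl))
    ∑-weights (e ∷ es) _ [] _ _ _ = z≤n
    ∑-weights (e ∷ es) (e≤es ∷ sorted) L@(X₀ ∷ _) unique proper agree = begin
      ∑ L (λ X → weight X e * ∏ es (weight X))
        -- By the sorting, all edges earlier than `e` are already coloured, so every member of `L`
        -- has as many choices at `e` as `X₀`.
        ≡⟨ Sum.⨁-cong L (λ X X∈L → cong (λ z → cofactor k z * ∏ es (weight X)) (choices-cong X X₀ e (λ f f<e → seen f f<e (agree f) X∈L (here refl)))) ⟩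
      ∑ L (λ X → w₀ * ∏ es (weight X))
        ≡⟨ *-distribˡ-∑ w₀ _ L ⟨
      w₀ * ∑ L (λ X → ∏ es (weight X))
        ≡⟨ cong (w₀ *_) (Sum.⨁-fibres k (λ X → lookup X e) _ L) ⟩
      w₀ * ∑ (allFin k) (λ c → ∑ (fibre c) (λ X → ∏ es (weight X)))
        ≤⟨ *-monoʳ-≤ w₀ (∑-mono (allFin k) (λ c _ → bound c)) ⟩
      w₀ * ∑ (allFin k) (λ c → D * ⟦ available? X₀ e c ⟧)
        ≡⟨ cong (w₀ *_) (*-distribˡ-∑ D _ (allFin k)) ⟨
      w₀ * (D * choices X₀ e)
        ≡⟨ eq w₀ D (choices X₀ e) ⟩
      w₀ * choices X₀ e * D
        ≡⟨ cong (_* D) (cofactor-* (choices-positive (proper (here refl)) e) (choices≤k X₀ e)) ⟩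
      k ! * D ∎
      where
      open ≤-Reasoning
      w₀ = weight X₀ e
      D = (k !) ^ length es
      eq : ∀ w d c → w * (d * c) ≡ w * c * d
      eq = solve-∀
      fibre : Fin k → List Col
      fibre c = filter (λ X → lookup X e Fin.≟ c) L
      seen : ∀ f → time f < time e → f ∈ e ∷ es ⊎ Agree L f → Agree L f
      seen f f<e (inj₁ (here refl)) = contradiction f<e (<-irrefl refl)
      seen f f<e (inj₁ (there f∈es)) = contradiction f<e (≤⇒≯ (All.lookup e≤es f∈es))
      seen f f<e (inj₂ agree-f) = agree-f
      refine : ∀ c f → f ∈ e ∷ es ⊎ Agree L f → f ∈ es ⊎ Agree (fibre c) f
      refine c f (inj₁ (here refl))   = inj₂ λ X∈ Y∈ →
        trans (proj₂ (∈-filter⁻ (λ X → lookup X e Fin.≟ c) {xs = L} X∈))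
                (sym (proj₂ (∈-filter⁻ (λ X → lookup X e Fin.≟ c) {xs = L} Y∈)))
      refine c f (inj₁ (there f∈es)) = inj₁ f∈es
      refine c f (inj₂ agree-f) = inj₂ λ X∈ Y∈ →
        agree-f (proj₁ (∈-filter⁻ (λ X → lookup X e Fin.≟ c) {xs = L} X∈))
                (proj₁ (∈-filter⁻ (λ X → lookup X e Fin.≟ c) {xs = L} Y∈))
      bound : ∀ c → ∑ (fibre c) (λ X → ∏ es (weight X)) ≤ D * ⟦ available? X₀ e c ⟧
      bound c with available? X₀ e c
      ... | yes _ = ≤-trans (∑-weights es sorted (fibre c) (Unique.filter⁺ (λ X → lookup X e Fin.≟ c) unique)
              (λ X∈ → proper (proj₁ (∈-filter⁻ (λ X → lookup X e Fin.≟ c) {xs = L} X∈)))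
              (λ f → refine c f (agree f))) (≤-reflexive (sym (*-identityʳ D)))
      ... | no ¬av = ≤-trans (≤-reflexive (cong (λ xs → ∑ xs (λ X → ∏ es (weight X)))
              (List.filter-none (λ X → lookup X e Fin.≟ c) (All.tabulate unavailable)))) z≤n
        where
        unavailable : ∀ {X} → X ∈ L → lookup X e ≢ c
        unavailable {X} X∈L refl = ¬av λ f adj f<e eq →
          available-own {X} (proper X∈L) e f adj f<e (trans (seen f f<e (agree f) X∈L (here refl)) eq)

    -- AM-GM for the weights of the colourings in `L`. As weight times choices is `k!` at each edge,
    -- the product of all weights occurs on both sides and cancels, leaving the choices.
    length^length≤∏∏choices : ∀ L → Unique L → (∀ {X} → X ∈ L → ProperCol X) →
      length L ^ length L ≤ ∏ L (λ X → ∏ (allFin m) (choices X))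
    length^length≤∏∏choices L unique proper = *-cancelˡ-≤ _ {{>-nonZero positive}} (begin
      ∏ L (λ X → ∏ es (weight X)) * length L ^ length L
        ≤⟨ am-gm (λ X → ∏ es (weight X)) L ⟩
      ∑ L (λ X → ∏ es (weight X)) ^ length L
        ≤⟨ ^-monoˡ-≤ (length L) (∑-weights es sorted L unique proper (λ f → inj₁ (∈-resp-↭ (↭-sym es↭) (∈-allFin f)))) ⟩
      ((k !) ^ length es) ^ length L
        ≡⟨ ∏-const _ L ⟨
      ∏ L (λ X → (k !) ^ length es)
        ≡⟨ Prod.⨁-cong L (λ X X∈L → sym (complementary X X∈L)) ⟩
      ∏ L (λ X → ∏ es (weight X) * ∏ es (choices X))
        ≡⟨ Prod.⨁-∙ _ _ L ⟩
      ∏ L (λ X → ∏ es (weight X)) * ∏ L (λ X → ∏ es (choices X))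
        ≡⟨ cong (∏ L (λ X → ∏ es (weight X)) *_) (Prod.⨁-cong L (λ X _ → Prod.⨁-↭ (choices X) es↭)) ⟩
      ∏ L (λ X → ∏ es (weight X)) * ∏ L (λ X → ∏ (allFin m) (choices X)) ∎)
      where
      open ≤-Reasoning
      byTime : DecTotalOrder 0ℓ 0ℓ 0ℓ
      byTime = On.decTotalOrder ≤-decTotalOrder time
      es : List (Fin m)
      es = Sort.sort byTime (allFin m)
      es↭ : es ↭ allFin m
      es↭ = Sort.sort-↭ byTime (allFin m)
      sorted : AllPairs (λ e f → time e ≤ time f) es
      sorted = Sorted⇒AllPairs (DecTotalOrder.totalOrder byTime) (Sort.sort-↗ byTime (allFin m))
      weight-choices : ∀ X → X ∈ L → ∀ e → weight X e * choices X e ≡ k !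
      weight-choices X X∈L e = cofactor-* (choices-positive (proper X∈L) e) (choices≤k X e)
      complementary : ∀ X → X ∈ L → ∏ es (weight X) * ∏ es (choices X) ≡ (k !) ^ length es
      complementary X X∈L = trans (sym (Prod.⨁-∙ (weight X) (choices X) es))
        (trans (Prod.⨁-cong es (λ e _ → weight-choices X X∈L e)) (∏-const (k !) es))
      positive : 0 < ∏ L (λ X → ∏ es (weight X))
      positive = ∏-positive _ L λ X X∈L → ∏-positive _ es λ e _ →
        m*n>0⇒m>0 (weight X e) (choices X e) (≤-trans (!-positive k) (≤-reflexive (sym (weight-choices X X∈L e))))
        where
        m*n>0⇒m>0 : ∀ m n → 0 < m * n → 0 < m
        m*n>0⇒m>0 (suc _) _ _ = s≤s z≤n

  -- What 1-factorizations provide: `f` and `g` will be the edges of colour `c` at the two ends of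
  -- `e`. That they differ makes their times independent.
  Saturated : Col → Set
  Saturated X = ∀ e c → lookup X e ≢ c →
    Σ (Fin m) λ f → Σ (Fin m) λ g → f ≢ g × (Adj e f × lookup X f ≡ c) × (Adj e g × lookup X g ≡ c)

  -- The mean number of choices over random times.

  module _ (T : ℕ) where

    slot : Fin m → Fin T → List (Vec (Fin T) m)
    slot e t = filter (λ τ → lookup τ e Fin.≟ t) (allVecs T m)

    -- The time of `e` is `t` with probability `1 / T`; the factor `T` avoids the exponent `m - 1`.
    T*length-slot : ∀ e t → T * length (slot e t) ≡ T ^ m
    T*length-slot e t = begin
      T * length (slot e t)
        ≡⟨ cong (T *_) (trans (sym (*-identityʳ _)) (sym (∑-const 1 (slot e t)))) ⟩
      T * ∑ (slot e t) (λ _ → 1)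
        ≡⟨ cong (T *_) (∑-filter (λ τ → lookup τ e Fin.≟ t) (λ _ → 1) (allVecs T m)) ⟩
      T * ∑ (allVecs T m) (λ τ → ⟦ lookup τ e Fin.≟ t ⟧ * 1)
        ≡⟨ ∑-independent T m e (λ x → ⟦ x Fin.≟ t ⟧) (λ _ → 1) (λ _ _ → refl) ⟩
      ∑ (allFin T) (λ x → ⟦ x Fin.≟ t ⟧) * ∑ (allVecs T m) (λ _ → 1)
        ≡⟨ cong₂ _*_ (trans (Sum.⨁-cong (allFin T) (λ x _ → flip x)) (Sum.⨁-single T t 1)) (∑-const 1 (allVecs T m)) ⟩
      1 * (length (allVecs T m) * 1)
        ≡⟨ trans (*-identityˡ _) (*-identityʳ _) ⟩
      length (allVecs T m)
        ≡⟨ length-allVecs T m ⟩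
      T ^ m ∎
      where
      open ≡-Reasoning
      flip : ∀ x → ⟦ x Fin.≟ t ⟧ ≡ ⟦ t Fin.≟ x ⟧
      flip x = ≤-antisym (⟦⟧-mono (x Fin.≟ t) (t Fin.≟ x) sym) (⟦⟧-mono (t Fin.≟ x) (x Fin.≟ t) sym)

    -- Given that `e` has time `t`, each of `f` and `g` is not earlier with probability
    -- `(T - t) / T`, independently. As the three edges differ, `∑-independent` splits off first `f`
    -- and then `g`.
    ∑-both-late : ∀ e t f g → e ≢ f → e ≢ g → f ≢ g →
      T * T * ∑ (slot e t) (λ τ → ⟦ ¬? (time τ f <? toℕ t) ⟧ * ⟦ ¬? (time τ g <? toℕ t) ⟧)
        ≡ (T ∸ toℕ t) * (T ∸ toℕ t) * length (slot e t)
    ∑-both-late e t f g e≢f e≢g f≢g = begin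
      T * T * ∑ (slot e t) (λ τ → late (lookup τ f) * late (lookup τ g))
        ≡⟨ cong (T * T *_) (∑-filter at-t? _ (allVecs T m)) ⟩
      T * T * ∑ (allVecs T m) (λ τ → ⟦ at-t? τ ⟧ * (late (lookup τ f) * late (lookup τ g)))
        ≡⟨ cong (T * T *_) (Sum.⨁-cong (allVecs T m) (λ τ _ → eq₁ ⟦ at-t? τ ⟧ (late (lookup τ f)) (late (lookup τ g)))) ⟩
      T * T * ∑ (allVecs T m) (λ τ → late (lookup τ f) * (late (lookup τ g) * ⟦ at-t? τ ⟧))
        ≡⟨ *-assoc T T _ ⟩
      T * (T * ∑ (allVecs T m) (λ τ → late (lookup τ f) * (late (lookup τ g) * ⟦ at-t? τ ⟧)))
        ≡⟨ cong (T *_) (∑-independent T m f late (λ τ → late (lookup τ g) * ⟦ at-t? τ ⟧)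
             (λ τ x → cong₂ (λ y z → late y * ⟦ z Fin.≟ t ⟧) (lookup∘update′ (f≢g ∘ sym) τ x) (lookup∘update′ e≢f τ x))) ⟩
      T * (∑ (allFin T) late * ∑ (allVecs T m) (λ τ → late (lookup τ g) * ⟦ at-t? τ ⟧))
        ≡⟨ eq₂ T (∑ (allFin T) late) _ ⟩
      ∑ (allFin T) late * (T * ∑ (allVecs T m) (λ τ → late (lookup τ g) * ⟦ at-t? τ ⟧))
        ≡⟨ cong (∑ (allFin T) late *_) (∑-independent T m g late (λ τ → ⟦ at-t? τ ⟧)
             (λ τ x → cong (λ z → ⟦ z Fin.≟ t ⟧) (lookup∘update′ e≢g τ x))) ⟩
      ∑ (allFin T) late * (∑ (allFin T) late * ∑ (allVecs T m) (λ τ → ⟦ at-t? τ ⟧))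
        ≡⟨ cong₂ (λ a b → a * (a * b)) (∑-∸ T t) count ⟩
      (T ∸ toℕ t) * ((T ∸ toℕ t) * length (slot e t))
        ≡⟨ *-assoc (T ∸ toℕ t) (T ∸ toℕ t) _ ⟨
      (T ∸ toℕ t) * (T ∸ toℕ t) * length (slot e t) ∎
      where
      open ≡-Reasoning
      at-t? : ∀ τ → Dec (lookup τ e ≡ t)
      at-t? τ = lookup τ e Fin.≟ t
      late : Fin T → ℕ
      late x = ⟦ ¬? (toℕ x <? toℕ t) ⟧
      eq₁ : ∀ a b c → a * (b * c) ≡ b * (c * a)
      eq₁ = solve-∀
      eq₂ : ∀ a b c → a * (b * c) ≡ b * (a * c)
      eq₂ = solve-∀
      count : ∑ (allVecs T m) (λ τ → ⟦ at-t? τ ⟧) ≡ length (slot e t)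
      count = begin
        ∑ (allVecs T m) (λ τ → ⟦ at-t? τ ⟧)       ≡⟨ Sum.⨁-filter at-t? (λ _ → 1) (allVecs T m) ⟨
        ∑ (slot e t) (λ _ → 1)                    ≡⟨ ∑-const 1 (slot e t) ⟩
        length (slot e t) * 1                     ≡⟨ *-identityʳ _ ⟩
        length (slot e t)                         ∎

    module _ {X : Col} (saturated : Saturated X) (e : Fin m) (t : Fin T) where
      private
        s = T ∸ toℕ t
        r = length (slot e t)

        0<s : 0 < s
        0<s = m<n⇒0<n∸m (Fin.toℕ<n t)

      -- For a colour other than that of `e`, availability forces both edges from `saturated` not to
      -- be earlier than `e`, so `∑-both-late` applies. For the colour of `e` itself the indicator
      -- is bounded by 1.
      ∑-available : ∀ c → T * T * ∑ (slot e t) (λ τ → ⟦ available? τ X e c ⟧)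
        ≤ ⟦ lookup X e Fin.≟ c ⟧ * (T * T * r) + s * s * r
      ∑-available c with lookup X e Fin.≟ c
      ... | yes _ = begin
        T * T * ∑ (slot e t) (λ τ → ⟦ available? τ X e c ⟧)
          ≤⟨ *-monoʳ-≤ (T * T) (∑-mono (slot e t) (λ τ _ → ⟦⟧≤1 (available? τ X e c))) ⟩
        T * T * ∑ (slot e t) (λ _ → 1)
          ≡⟨ cong (T * T *_) (trans (∑-const 1 (slot e t)) (*-identityʳ r)) ⟩
        T * T * r
          ≡⟨ *-identityˡ _ ⟨
        1 * (T * T * r)
          ≤⟨ m≤m+n _ _ ⟩
        1 * (T * T * r) + s * s * r ∎
        where open ≤-Reasoning
      ... | no Xe≢c with f , g , f≢g , (adj-f , Xf≡c) , (adj-g , Xg≡c) ← saturated e c Xe≢c = begin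
        T * T * ∑ (slot e t) (λ τ → ⟦ available? τ X e c ⟧)
          ≤⟨ *-monoʳ-≤ (T * T) (∑-mono (slot e t) λ τ τ∈ → both-late τ (proj₂ (∈-filter⁻ (λ τ → lookup τ e Fin.≟ t) {xs = allVecs T m} τ∈))) ⟩
        T * T * ∑ (slot e t) (λ τ → ⟦ ¬? (time τ f <? toℕ t) ⟧ * ⟦ ¬? (time τ g <? toℕ t) ⟧)
          ≡⟨ ∑-both-late e t f g (λ { refl → Xe≢c Xf≡c }) (λ { refl → Xe≢c Xg≡c }) f≢g ⟩
        s * s * r ∎
        where
        open ≤-Reasoning
        both-late : ∀ τ → lookup τ e ≡ t →
          ⟦ available? τ X e c ⟧ ≤ ⟦ ¬? (time τ f <? toℕ t) ⟧ * ⟦ ¬? (time τ g <? toℕ t) ⟧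
        both-late τ refl with available? τ X e c
        ... | no  _  = z≤n
        ... | yes av = *-mono-≤
          (≤-reflexive (sym (⟦⟧-true (¬? (time τ f <? time τ e)) λ f<e → av f adj-f f<e Xf≡c)))
          (≤-reflexive (sym (⟦⟧-true (¬? (time τ g <? time τ e)) λ g<e → av g adj-g g<e Xg≡c)))

      ∑-choices : T * T * ∑ (slot e t) (λ τ → choices τ X e) ≤ r * (s * s * (k + T * T))
      ∑-choices = begin
        T * T * ∑ (slot e t) (λ τ → choices τ X e)
          ≡⟨ cong (T * T *_) (Sum.⨁-comm _ (slot e t) (allFin k)) ⟩
        T * T * ∑ (allFin k) (λ c → ∑ (slot e t) (λ τ → ⟦ available? τ X e c ⟧))
          ≡⟨ *-distribˡ-∑ (T * T) _ (allFin k) ⟩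
        ∑ (allFin k) (λ c → T * T * ∑ (slot e t) (λ τ → ⟦ available? τ X e c ⟧))
          ≤⟨ ∑-mono (allFin k) (λ c _ → ∑-available c) ⟩
        ∑ (allFin k) (λ c → ⟦ lookup X e Fin.≟ c ⟧ * (T * T * r) + s * s * r)
          ≡⟨ Sum.⨁-∙ _ _ (allFin k) ⟩
        ∑ (allFin k) (λ c → ⟦ lookup X e Fin.≟ c ⟧ * (T * T * r)) + ∑ (allFin k) (λ _ → s * s * r)
          ≡⟨ cong₂ _+_ once (trans (∑-const _ (allFin k)) (cong (_* (s * s * r)) (length-allFin k))) ⟩
        T * T * r + k * (s * s * r)
          -- Enlarging the term of the own colour by `s² ≥ 1` makes `s²` a common factor, so that
          -- the product over `t` separates; the cost is only the constant `T²` beside `k`.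
          ≤⟨ +-monoˡ-≤ _ (m≤n*m (T * T * r) (s * s) {{>-nonZero (*-mono-≤ 0<s 0<s)}}) ⟩
        s * s * (T * T * r) + k * (s * s * r)
          ≡⟨ eq (s * s) (T * T) r k ⟩
        r * (s * s * (k + T * T)) ∎
        where
        open ≤-Reasoning
        eq : ∀ s t r k → s * (t * r) + k * (s * r) ≡ r * (s * (k + t))
        eq = solve-∀
        once : ∑ (allFin k) (λ c → ⟦ lookup X e Fin.≟ c ⟧ * (T * T * r)) ≡ T * T * r
        once = begin-equality
          ∑ (allFin k) (λ c → ⟦ lookup X e Fin.≟ c ⟧ * (T * T * r))
            ≡⟨ Sum.⨁-cong (allFin k) (λ c _ → *-comm ⟦ lookup X e Fin.≟ c ⟧ (T * T * r)) ⟩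
          ∑ (allFin k) (λ c → T * T * r * ⟦ lookup X e Fin.≟ c ⟧)
            ≡⟨ *-distribˡ-∑ (T * T * r) _ (allFin k) ⟨
          T * T * r * ∑ (allFin k) (λ c → ⟦ lookup X e Fin.≟ c ⟧)
            ≡⟨ cong (T * T * r *_) (Sum.⨁-single k (lookup X e) 1) ⟩
          T * T * r * 1
            ≡⟨ *-identityʳ _ ⟩
          T * T * r ∎

      ∏-choices-slot : (T * T) ^ r * ∏ (slot e t) (λ τ → choices τ X e) ≤ (s * s * (k + T * T)) ^ r
      ∏-choices-slot with r | am-gm (λ τ → choices τ X e) (slot e t) | ∑-choices
      ... | zero      | gm | _  = ≤-trans (≤-reflexive (trans (*-identityˡ _) (sym (*-identityʳ _)))) gm
      ... | r@(suc _) | gm | am = *-cancelˡ-≤ (r ^ r) {{m^n≢0 r r}} (begin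
        r ^ r * ((T * T) ^ r * p)
          ≡⟨ eq (r ^ r) ((T * T) ^ r) p ⟩
        (T * T) ^ r * (p * r ^ r)
          ≤⟨ *-monoʳ-≤ ((T * T) ^ r) gm ⟩
        (T * T) ^ r * ∑ (slot e t) (λ τ → choices τ X e) ^ r
          ≡⟨ ^-distribʳ-* (T * T) _ r ⟨
        (T * T * ∑ (slot e t) (λ τ → choices τ X e)) ^ r
          ≤⟨ ^-monoˡ-≤ r am ⟩
        (r * (s * s * (k + T * T))) ^ r
          ≡⟨ ^-distribʳ-* r (s * s * (k + T * T)) r ⟩
        r ^ r * (s * s * (k + T * T)) ^ r ∎)
        where
        open ≤-Reasoning
        p = ∏ (slot e t) (λ τ → choices τ X e)
        eq : ∀ a b c → a * (b * c) ≡ b * (c * a)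
        eq = solve-∀

      -- Raising to the power `T` turns the exponent `r` into `T ^ m`, which depends on neither `e`
      -- nor `t`.
      ∏-choices-slot^T : (T * T) ^ (T ^ m) * ∏ (slot e t) (λ τ → choices τ X e) ^ T
        ≤ (s * s * (k + T * T)) ^ (T ^ m)
      ∏-choices-slot^T = begin
        (T * T) ^ (T ^ m) * p ^ T         ≡⟨ cong (_* p ^ T) (slot-power (T * T)) ⟩
        ((T * T) ^ r) ^ T * p ^ T         ≡⟨ ^-distribʳ-* ((T * T) ^ r) p T ⟨
        ((T * T) ^ r * p) ^ T             ≤⟨ ^-monoˡ-≤ T ∏-choices-slot ⟩
        ((s * s * (k + T * T)) ^ r) ^ T   ≡⟨ slot-power (s * s * (k + T * T)) ⟨
        (s * s * (k + T * T)) ^ (T ^ m)   ∎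
        where
        open ≤-Reasoning
        p = ∏ (slot e t) (λ τ → choices τ X e)
        slot-power : ∀ x → x ^ (T ^ m) ≡ (x ^ r) ^ T
        slot-power x = trans (cong (x ^_) (trans (sym (T*length-slot e t)) (*-comm T r))) (sym (^-*-assoc x r T))

    -- The slots of `e` partition the time vectors; multiplying their bounds over `t` turns `s²`
    -- into `(T!)²`.
    ∏-choices : ∀ {X} → Saturated X → ∀ e →
      ((T * T) ^ T) ^ (T ^ m) * ∏ (allVecs T m) (λ τ → choices τ X e) ^ T
        ≤ (T ! * T ! * (k + T * T) ^ T) ^ (T ^ m)
    ∏-choices {X} saturated e = begin
      ((T * T) ^ T) ^ Θ * ∏ (allVecs T m) (λ τ → choices τ X e) ^ T
        ≡⟨ cong₂ _*_ (^-comm (T * T) T Θ) (cong (_^ T) (Prod.⨁-fibres T (λ τ → lookup τ e) _ (allVecs T m))) ⟩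
      ((T * T) ^ Θ) ^ T * ∏ (allFin T) p ^ T
        ≡⟨ cong₂ _*_ (∏-allFin-const ((T * T) ^ Θ)) (^-distribʳ-∏ T p (allFin T)) ⟩
      ∏ (allFin T) (λ _ → (T * T) ^ Θ) * ∏ (allFin T) (λ t → p t ^ T)
        ≡⟨ Prod.⨁-∙ _ _ (allFin T) ⟨
      ∏ (allFin T) (λ t → (T * T) ^ Θ * p t ^ T)
        ≤⟨ ∏-mono (allFin T) (λ t _ → ∏-choices-slot^T saturated e t) ⟩
      ∏ (allFin T) (λ t → ((T ∸ toℕ t) * (T ∸ toℕ t) * Q) ^ Θ)
        ≡⟨ ^-distribʳ-∏ Θ _ (allFin T) ⟨
      ∏ (allFin T) (λ t → (T ∸ toℕ t) * (T ∸ toℕ t) * Q) ^ Θ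
        ≡⟨ cong (_^ Θ) (trans (Prod.⨁-∙ _ _ (allFin T))
             (cong₂ _*_ (trans (Prod.⨁-∙ _ _ (allFin T)) (cong₂ _*_ (∏-∸ T) (∏-∸ T))) (sym (∏-allFin-const Q)))) ⟩
      (T ! * T ! * Q ^ T) ^ Θ ∎
      where
      open ≤-Reasoning
      Θ = T ^ m
      Q = k + T * T
      p : Fin T → ℕ
      p t = ∏ (slot e t) (λ τ → choices τ X e)
      ∏-allFin-const : ∀ c → c ^ T ≡ ∏ (allFin T) (λ _ → c)
      ∏-allFin-const c = sym (trans (∏-const c (allFin T)) (cong (c ^_) (length-allFin T)))

    -- The bound for one time vector is multiplied over all `T ^ m` of them. Exchanging the products
    -- isolates, for each colouring and edge, a product over times to which `∏-choices` applies; at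
    -- the end the root of order `l * Θ` is taken.
    coloring-bound : ∀ L → 0 < T → Unique L → (∀ {X} → X ∈ L → ProperCol X) → (∀ {X} → X ∈ L → Saturated X) →
      length L ^ T * ((T * T) ^ T) ^ m ≤ (T ! * T ! * (k + T * T) ^ T) ^ m
    -- The root requires `l > 0`; without colourings the left side is 0 because `0 ^ T = 0` for
    -- `T > 0`.
    coloring-bound [] 0<T@(s≤s _) _ _ _ = z≤n
    coloring-bound L@(_ ∷ _) 0<T unique proper saturated =
      ^-cancelˡ-≤ (l * Θ) (*-mono-≤ (s≤s (z≤n {n = l ∸ 1})) (^-positive m 0<T)) (begin
        (l ^ T * R ^ m) ^ (l * Θ)
          ≡⟨ ^-distribʳ-* (l ^ T) (R ^ m) (l * Θ) ⟩
        (l ^ T) ^ (l * Θ) * (R ^ m) ^ (l * Θ)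
          ≡⟨ cong₂ _*_ (trans (^-comm l T (l * Θ)) (cong (_^ T) (sym (^-*-assoc l l Θ)))) (spread R) ⟩
        ((l ^ l) ^ Θ) ^ T * ∏ L (λ _ → ∏ (allFin m) (λ _ → R ^ Θ))
          ≤⟨ *-monoˡ-≤ _ (^-monoˡ-≤ T all-orders) ⟩
        ∏ L (λ X → ∏ (allFin m) (λ e → ∏ Ω (λ τ → choices τ X e))) ^ T * ∏ L (λ _ → ∏ (allFin m) (λ _ → R ^ Θ))
          ≡⟨ cong (_* ∏ L (λ _ → ∏ (allFin m) (λ _ → R ^ Θ)))
               (trans (^-distribʳ-∏ T _ L) (Prod.⨁-cong L (λ X _ → ^-distribʳ-∏ T _ (allFin m)))) ⟩
        ∏ L (λ X → ∏ (allFin m) (λ e → ∏ Ω (λ τ → choices τ X e) ^ T)) * ∏ L (λ _ → ∏ (allFin m) (λ _ → R ^ Θ))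
          ≡⟨ Prod.⨁-∙ (λ X → ∏ (allFin m) (λ e → ∏ Ω (λ τ → choices τ X e) ^ T)) (λ _ → ∏ (allFin m) (λ _ → R ^ Θ)) L ⟨
        ∏ L (λ X → ∏ (allFin m) (λ e → ∏ Ω (λ τ → choices τ X e) ^ T) * ∏ (allFin m) (λ _ → R ^ Θ))
          ≡⟨ Prod.⨁-cong L (λ X _ → Prod.⨁-∙ (λ e → ∏ Ω (λ τ → choices τ X e) ^ T) (λ _ → R ^ Θ) (allFin m)) ⟨
        ∏ L (λ X → ∏ (allFin m) (λ e → ∏ Ω (λ τ → choices τ X e) ^ T * R ^ Θ))
          ≤⟨ ∏-mono L (λ X X∈L → ∏-mono (allFin m) (λ e _ →
               ≤-trans (≤-reflexive (*-comm _ (R ^ Θ))) (∏-choices (saturated X∈L) e))) ⟩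
        ∏ L (λ _ → ∏ (allFin m) (λ _ → P ^ Θ))
          ≡⟨ spread P ⟨
        (P ^ m) ^ (l * Θ) ∎)
      where
      open ≤-Reasoning
      l = length L
      Θ = T ^ m
      Ω = allVecs T m
      R = (T * T) ^ T
      P = T ! * T ! * (k + T * T) ^ T
      spread : ∀ x → (x ^ m) ^ (l * Θ) ≡ ∏ L (λ _ → ∏ (allFin m) (λ _ → x ^ Θ))
      spread x = begin-equality
        (x ^ m) ^ (l * Θ)                              ≡⟨ cong ((x ^ m) ^_) (*-comm l Θ) ⟩
        (x ^ m) ^ (Θ * l)                              ≡⟨ ^-*-assoc (x ^ m) Θ l ⟨
        ((x ^ m) ^ Θ) ^ l                              ≡⟨ cong (_^ l) (^-comm x m Θ) ⟩
        ((x ^ Θ) ^ m) ^ l                              ≡⟨ cong (λ z → ((x ^ Θ) ^ z) ^ l) (length-allFin m) ⟨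
        ((x ^ Θ) ^ length (allFin m)) ^ l              ≡⟨ cong (_^ l) (∏-const (x ^ Θ) (allFin m)) ⟨
        ∏ (allFin m) (λ _ → x ^ Θ) ^ l                 ≡⟨ ∏-const (∏ (allFin m) (λ _ → x ^ Θ)) L ⟨
        ∏ L (λ _ → ∏ (allFin m) (λ _ → x ^ Θ))         ∎
      all-orders : (l ^ l) ^ Θ ≤ ∏ L (λ X → ∏ (allFin m) (λ e → ∏ Ω (λ τ → choices τ X e)))
      all-orders = begin
        (l ^ l) ^ Θ
          ≡⟨ cong ((l ^ l) ^_) (length-allVecs T m) ⟨
        (l ^ l) ^ length Ω
          ≡⟨ ∏-const (l ^ l) Ω ⟨
        ∏ Ω (λ _ → l ^ l)
          ≤⟨ ∏-mono Ω (λ τ _ → length^length≤∏∏choices τ L unique proper) ⟩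
        ∏ Ω (λ τ → ∏ L (λ X → ∏ (allFin m) (choices τ X)))
          ≡⟨ Prod.⨁-comm _ Ω L ⟩
        ∏ L (λ X → ∏ Ω (λ τ → ∏ (allFin m) (choices τ X)))
          ≡⟨ Prod.⨁-cong L (λ X _ → Prod.⨁-comm _ Ω (allFin m)) ⟩
        ∏ L (λ X → ∏ (allFin m) (λ e → ∏ Ω (λ τ → choices τ X e))) ∎

-- Complete graphs

allVecs-unique : ∀ k m → Unique (allVecs k m)
allVecs-unique k zero    = [] ∷ []
allVecs-unique k (suc m) = extend (allFin k) (Unique.allFin⁺ k)
  where
  extend : ∀ xs → Unique xs → Unique (concatMap (λ x → map (x Vec.∷_) (allVecs k m)) xs)
  extend []       _                = []
  extend (x ∷ xs) (x∉xs ∷ unique) = Unique.++⁺ (Unique.map⁺ (λ { refl → refl }) (allVecs-unique k m)) (extend xs unique)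
    λ { (v∈ , v∈′) → disjoint v∈ xs x∉xs v∈′ }
    where
    disjoint : ∀ {v} → v ∈ map (x Vec.∷_) (allVecs k m) → ∀ xs → All (x ≢_) xs →
      ¬ (v ∈ concatMap (λ x → map (x Vec.∷_) (allVecs k m)) xs)
    disjoint v∈ (y ∷ ys) (x≢y ∷ x∉ys) v∈′ with ∈-++⁻ (map (y Vec.∷_) (allVecs k m)) v∈′
    ... | inj₂ v∈ys = disjoint v∈ ys x∉ys v∈ys
    ... | inj₁ v∈y with _ , _ , refl ← ∈-map⁻ (x Vec.∷_) v∈ | _ , _ , eq ← ∈-map⁻ (y Vec.∷_) v∈y =
      x≢y (cong Vec.head eq)

lookup-injective : ∀ {A : Set} {xs : List A} → Unique xs → ∀ i j → List.lookup xs i ≡ List.lookup xs j → i ≡ j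
lookup-injective (_ ∷ _)      zero    zero    _  = refl
lookup-injective (x∉xs ∷ _)   zero    (suc j) eq = contradiction eq (All.lookup x∉xs (∈-lookup j))
lookup-injective (x∉xs ∷ _)   (suc i) zero    eq = contradiction (sym eq) (All.lookup x∉xs (∈-lookup i))
lookup-injective (_ ∷ unique) (suc i) (suc j) eq = cong suc (lookup-injective unique i j eq)

-- Pigeonhole: if `c` were missed, deleting it from the codomain would inject `suc k` elements into
-- `k`.
injective⇒surjective : ∀ {k} (f : Fin k → Fin k) → (∀ {i j} → f i ≡ f j → i ≡ j) → ∀ c → Σ (Fin k) λ i → f i ≡ c
injective⇒surjective {suc k} f f-inj c with Fin.any? (λ i → f i Fin.≟ c)
... | yes hit  = hit
... | no  miss = contradiction
  (Fin.injective⇒≤ {f = λ i → punchOut (c≢f i)} (λ {i} {j} eq → f-inj (Fin.punchOut-injective (c≢f i) (c≢f j) eq))) 1+n≰n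
  where
  c≢f : ∀ i → c ≢ f i
  c≢f i c≡fi = miss (i , sym c≡fi)

∑-cartesianProduct : ∀ {X Y : Set} (f : X × Y → ℕ) xs ys →
  ∑ (cartesianProduct xs ys) f ≡ ∑ xs (λ x → ∑ ys (λ y → f (x , y)))
∑-cartesianProduct f []       ys = refl
∑-cartesianProduct f (x ∷ xs) ys = trans (Sum.⨁-++ f (map (x ,_) ys) (cartesianProduct xs ys))
  (cong₂ _+_ (Sum.⨁-map f (x ,_) ys) (∑-cartesianProduct f xs ys))

⟦⟧-exclusive : ∀ {P Q : Set} (P? : Dec P) (Q? : Dec Q) → (P → ¬ Q) → ⟦ P? ⟧ + ⟦ Q? ⟧ ≤ 1
⟦⟧-exclusive (no _)  Q? _    = ⟦⟧≤1 Q?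
⟦⟧-exclusive (yes p) Q? P⇒¬Q = ≤-reflexive (cong suc (⟦⟧-false Q? (P⇒¬Q p)))

-- An ordered pair cannot be both increasing and decreasing, and there are `E n` pairs of either
-- kind.
2*E≤n² : ∀ n → 2 * E n ≤ n * n
2*E≤n² n = begin
    2 * E n
      ≡⟨ cong (E n +_) (+-identityʳ (E n)) ⟩
    E n + E n
      ≡⟨ cong₂ _+_ count (trans count (Sum.⨁-comm _ (allFin n) (allFin n))) ⟩
    ∑ (allFin n) (λ i → ∑ (allFin n) (λ j → ⟦ i Fin.<? j ⟧)) + ∑ (allFin n) (λ i → ∑ (allFin n) (λ j → ⟦ j Fin.<? i ⟧))
      ≡⟨ Sum.⨁-∙ _ _ (allFin n) ⟨
    ∑ (allFin n) (λ i → ∑ (allFin n) (λ j → ⟦ i Fin.<? j ⟧) + ∑ (allFin n) (λ j → ⟦ j Fin.<? i ⟧))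
      ≡⟨ Sum.⨁-cong (allFin n) (λ i _ → sym (Sum.⨁-∙ _ _ (allFin n))) ⟩
    ∑ (allFin n) (λ i → ∑ (allFin n) (λ j → ⟦ i Fin.<? j ⟧ + ⟦ j Fin.<? i ⟧))
      ≤⟨ ∑-mono (allFin n) (λ i _ → ∑-mono (allFin n) (λ j _ → one-order i j)) ⟩
    ∑ (allFin n) (λ i → ∑ (allFin n) (λ j → 1))
      ≡⟨ ∑-const _ (allFin n) ⟩
    length (allFin n) * ∑ (allFin n) (λ j → 1)
      ≡⟨ cong₂ _*_ (length-allFin n) (trans (∑-const 1 (allFin n)) (trans (*-identityʳ _) (length-allFin n))) ⟩
    n * n ∎
  where
  open ≤-Reasoning
  count : E n ≡ ∑ (allFin n) (λ i → ∑ (allFin n) (λ j → ⟦ i Fin.<? j ⟧))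
  count = begin-equality
    E n                        ≡⟨ *-identityʳ (E n) ⟨
    E n * 1                    ≡⟨ ∑-const 1 (edges n) ⟨
    ∑ (edges n) (λ _ → 1)      ≡⟨ Sum.⨁-filter (λ e → proj₁ e Fin.<? proj₂ e) (λ _ → 1) (cartesianProduct (allFin n) (allFin n)) ⟩
    ∑ (cartesianProduct (allFin n) (allFin n)) (λ e → ⟦ proj₁ e Fin.<? proj₂ e ⟧)
                               ≡⟨ ∑-cartesianProduct _ (allFin n) (allFin n) ⟩
    ∑ (allFin n) (λ i → ∑ (allFin n) (λ j → ⟦ i Fin.<? j ⟧)) ∎
  one-order : ∀ i j → ⟦ i Fin.<? j ⟧ + ⟦ j Fin.<? i ⟧ ≤ 1
  one-order i j = ⟦⟧-exclusive (i Fin.<? j) (j Fin.<? i) <⇒≯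

edges-unique : ∀ n → Unique (edges n)
edges-unique n = Unique.filter⁺ _ (Unique.cartesianProduct⁺ (Unique.allFin⁺ n) (Unique.allFin⁺ n))

edge-injective : ∀ n p q → edge n p ≡ edge n q → p ≡ q
edge-injective n = lookup-injective (edges-unique n)

edge-< : ∀ n p → proj₁ (edge n p) Fin.< proj₂ (edge n p)
edge-< n p = proj₂ (∈-filter⁻ (λ e → proj₁ e Fin.<? proj₂ e) {xs = cartesianProduct (allFin n) (allFin n)} (∈-lookup p))

-- `edges` lists every edge with its smaller end first, so both orientations have to be allowed.
Joins : ∀ n → Fin (E n) → Fin n → Fin n → Set
Joins n p u w = edge n p ≡ (u , w) ⊎ edge n p ≡ (w , u)

edge-between : ∀ n {u w} → u ≢ w → Σ (Fin (E n)) λ p → Joins n p u w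
edge-between n {u} {w} u≢w with Fin.<-cmp u w
... | tri≈ _ u≡w _ = contradiction u≡w u≢w
... | tri< u<w _ _ = index u,w∈ , inj₁ (sym (lookup-index u,w∈))
  where u,w∈ = ∈-filter⁺ (λ e → proj₁ e Fin.<? proj₂ e) (∈-cartesianProduct⁺ (∈-allFin u) (∈-allFin w)) u<w
... | tri> _ _ w<u = index w,u∈ , inj₂ (sym (lookup-index w,u∈))
  where w,u∈ = ∈-filter⁺ (λ e → proj₁ e Fin.<? proj₂ e) (∈-cartesianProduct⁺ (∈-allFin w) (∈-allFin u)) w<u

Joins-functional : ∀ n {p u v w} → Joins n p u v → Joins n p u w → v ≡ w
Joins-functional n (inj₁ a) (inj₁ b) = cong proj₂ (trans (sym a) b)
Joins-functional n (inj₁ a) (inj₂ b) = trans (cong proj₂ (trans (sym a) b)) (cong proj₁ (trans (sym a) b))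
Joins-functional n (inj₂ a) (inj₁ b) = trans (cong proj₁ (trans (sym a) b)) (cong proj₂ (trans (sym a) b))
Joins-functional n (inj₂ a) (inj₂ b) = cong proj₁ (trans (sym a) b)

Incident : ∀ n → Fin (E n) → Fin n → Set
Incident n p u = proj₁ (edge n p) ≡ u ⊎ proj₂ (edge n p) ≡ u

Joins⇒Incident : ∀ n {p u w} → Joins n p u w → Incident n p u
Joins⇒Incident n (inj₁ eq) = inj₁ (cong proj₁ eq)
Joins⇒Incident n (inj₂ eq) = inj₂ (cong proj₂ eq)

Incident⇒Adjacent : ∀ n {p q u} → Incident n p u → Incident n q u → Adjacent n p q
Incident⇒Adjacent n (inj₁ a) (inj₁ b) = inj₁ (inj₁ (trans a (sym b)))
Incident⇒Adjacent n (inj₁ a) (inj₂ b) = inj₁ (inj₂ (trans a (sym b)))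
Incident⇒Adjacent n (inj₂ a) (inj₁ b) = inj₂ (inj₁ (trans a (sym b)))
Incident⇒Adjacent n (inj₂ a) (inj₂ b) = inj₂ (inj₂ (trans a (sym b)))

-- The `k` edges at `u` have different colours by properness, and there are only `k` colours, so
-- each one occurs.
color-at-vertex : ∀ k {X : Coloring (suc k)} → Proper (suc k) X → ∀ u c →
  Σ (Fin (E (suc k))) λ p → Incident (suc k) p u × lookup X p ≡ c
color-at-vertex k {X} proper u c =
    let w , Xp≡c = injective⇒surjective color color-injective c
    in star w , Joins⇒Incident (suc k) (star-joins w) , Xp≡c
  where
  star : Fin k → Fin (E (suc k))
  star w = proj₁ (edge-between (suc k) (Fin.punchInᵢ≢i u w ∘ sym))
  star-joins : ∀ w → Joins (suc k) (star w) u (punchIn u w)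
  star-joins w = proj₂ (edge-between (suc k) (Fin.punchInᵢ≢i u w ∘ sym))
  color : Fin k → Fin k
  color w = lookup X (star w)
  color-injective : ∀ {v w} → color v ≡ color w → v ≡ w
  color-injective {v} {w} eq with star v Fin.≟ star w
  ... | yes same = Fin.punchIn-injective u v w
    (Joins-functional (suc k) (star-joins v) (subst (λ p → Joins (suc k) p u (punchIn u w)) (sym same) (star-joins w)))
  ... | no differ = contradiction eq (proper (star v) (star w) differ
    (Incident⇒Adjacent (suc k) (Joins⇒Incident (suc k) (star-joins v)) (Joins⇒Incident (suc k) (star-joins w))))

-- Both edges list their smaller end first, so of the four ways of matching ends only the
-- order-preserving one survives.
Incident-both : ∀ n p e → Incident n p (proj₁ (edge n e)) → Incident n p (proj₂ (edge n e)) → p ≡ e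
Incident-both n p e (inj₁ a) (inj₂ b) = edge-injective n p e (cong₂ _,_ a b)
Incident-both n p e (inj₁ a) (inj₁ b) = contradiction (trans (sym a) b) (Fin.<⇒≢ (edge-< n e))
Incident-both n p e (inj₂ a) (inj₂ b) = contradiction (trans (sym a) b) (Fin.<⇒≢ (edge-< n e))
Incident-both n p e (inj₂ a) (inj₁ b) = contradiction (edge-< n e)
  (<⇒≯ (subst₂ Fin._<_ b a (edge-< n p)))

module _ (k : ℕ) where
  open ConflictColoring {k} {E (suc k)} (adjacent? (suc k))

  -- The edges of colour `c` at the two ends of `e` differ, because an edge meeting both ends is
  -- `e`, whose colour is not `c`.
  proper⇒saturated : ∀ {X} → ProperCol X → Saturated X
  proper⇒saturated {X} proper e c Xe≢c =
    let u , v = edge (suc k) e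
        f , f∋u , Xf≡c = color-at-vertex k {X} proper u c
        g , g∋v , Xg≡c = color-at-vertex k {X} proper v c
    in f , g
      , (λ f≡g → Xe≢c (trans (cong (lookup X) (sym (Incident-both (suc k) f e f∋u
          (subst (λ p → Incident (suc k) p v) (sym f≡g) g∋v)))) Xf≡c))
      , (Incident⇒Adjacent (suc k) (inj₁ refl) f∋u , Xf≡c)
      , (Incident⇒Adjacent (suc k) (inj₂ refl) g∋v , Xg≡c)

  F-bound : ∀ T → 0 < T → F (suc k) ^ T * ((T * T) ^ T) ^ E (suc k) ≤ (T ! * T ! * (k + T * T) ^ T) ^ E (suc k)
  F-bound T 0<T = coloring-bound T (filter (proper? (suc k)) (allVecs k (E (suc k)))) 0<T
    (Unique.filter⁺ (proper? (suc k)) (allVecs-unique k (E (suc k)))) proper (λ {X} X∈ → proper⇒saturated {X} (proper X∈))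
    where
    proper : ∀ {X} → X ∈ filter (proper? (suc k)) (allVecs k (E (suc k))) → ProperCol X
    proper X∈ = proj₂ (∈-filter⁻ (proper? (suc k)) {xs = allVecs k (E (suc k))} X∈)

-- The integer form of the asymptotic bound: `F(n) ≤ (a n / b)^(n²/2)`, squared, for large `n` and
-- each fixed `a / b > e⁻²`. Letting `a / b` decrease to `e⁻²` gives the factor `1 + o(1)`.
theorem2 : (a b : ℕ) → 0 < b → AboveInvESq a b →
    Σ ℕ λ N → (n : ℕ) → N ≤ n → b ^ (n * n) * (F n * F n) ≤ (a * n) ^ (n * n)
theorem2 a b 0<b (k , above)
  with m , small ← factorial-below-power a b k 0<b above
  with N , eventually ← shifted-power-eventually (suc m) _ _ (suc m * suc m) (s≤s z≤n) small
  -- `suc N` excludes `n = 0`, so that `n = suc j` with `j = n - 1` colours.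
  = suc N , λ { (suc j) N<n → n²-power-bound a b T (suc j) (E (suc j)) (F (suc j)) (s≤s z≤n) (2*E≤n² (suc j))
      (≤-trans (≤-reflexive (*-comm (b ^ T * (T ! * T !)) _)) (eventually (suc j) (<⇒≤ N<n)))
      -- `F-bound` has the number of colours `n - 1` beside `T²`; it is enlarged to `n`.
      (≤-trans (F-bound j T (s≤s z≤n))
        (^-monoˡ-≤ (E (suc j)) (*-monoʳ-≤ (T ! * T !) (^-monoˡ-≤ T (n≤1+n (j + T * T)))))) }
  where
  T = suc m
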